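{- Let $Y_1(\mathcal D)$ and $Y_2(\mathcal D)$ be the two components of the graph $Y(\mathcal D)$ obtained from the Desargues graph $\mathcal D$ as described in the context. Then $Y_1(\mathcal D)$ and $Y_2(\mathcal D)$ are coherent $\{K_4,K_3\}_{K_2}$-ultrahomogeneous graphs composed by $5$ copies of $K_4$ and $10$ copies of $K_3$ not contained in a copy of $K_4$ each. Moreover, the $10$ vertices and the $10$ copies of $K_3$ not contained in a copy of $K_4$ in either graph constitute (as points and lines, respectively) the Desargues self-dual $(10_3)$ configuration, whose Levi graph is $\mathcal D$ and whose Menger graph is equal to both $Y_1(\mathcal D)$ and $Y_2(\mathcal D)$. Furthermore, both graphs are isomorphic to the line graph $L(K_5)$, whose complement is the Petersen graph.
   Context: **The graph $\mathcal D$.** The Desargues graph $\mathcal D$ is the cubic graph obtained from the $20$-cycle $(0,1,\ldots,19)$, whose vertices $4x,4x+1,4x+2,4x+3$ are renamed $x_0,x_1,x_2,x_3$ respectively ($x\in\mathbb Z_5$), by adding the edges $\{x_3,(x+2)_0\}$ and $\{x_1,(x+2)_2\}$ for $x\in\mathbb Z_5$ (operations mod $5$). **Oriented 6-cycles.** For $x\in\mathbb Z_5$ consider the oriented $6$-cycles of $\mathcal D$ (vertices listed in cyclic order): $A_x=(x_0\ x_1\ x_2\ x_3\ (x+1)_0\ (x+4)_3)$, $B_x=(x_1\ x_0\ (x+4)_3\ (x+4)_2\ (x+2)_1\ (x+2)_2)$, $C_x=(x_2\ x_1\ x_0\ (x+3)_3\ (x+3)_2\ (x+3)_1)$, $D_x=(x_0\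 (x+4)_3\ (x+1)_0\ (x+1)_1\ (x+3)_2\ (x+3)_3)$. These are orientations of the twenty $6$-cycles of $\mathcal D$ such that the two $6$-cycles sharing any given $2$-path traverse it in opposite directions. **The graph $Y(\mathcal D)$.** The square of an oriented $6$-cycle $(c_0\,c_1\ldots c_5)$ is the digraph on $\{c_0,\dots,c_5\}$ with arcs $(c_i,c_{i+2})$, $i\in\mathbb Z_6$; it consists of two disjoint oriented triangles. The graph $Y(\mathcal D)$ is obtained from the squares of the twenty oriented $6$-cycles above by cohering them along their pairs of oppositely oriented arcs, that is, by taking the union of each pair of opposite arcs $(u,v)$, $(v,u)$ (arising from the two opposite traversals of a common $2$-path) as one undirected edge $\{u,v\}$. It has two components, $Y_1(\mathcal D)$ (with vertices $x_0,x_2$, $x\in\mathbb Z_5$) and $Y_2(\mathcal D)$ (with vertices $x_1,x_3$, $x\in\mathbb Z_5$). **Ultrahomogeneity.** A graph $G$ is $H$-ultrahomogeneous ($H$-UH) if every isomorphism between two induced copies of $H$ in $G$ extends to an automorphism of $G$. Let $M$ be an induced subgraph of a graph $H$ and let $G$ be both $M$-UH and $H$-UH. Then $G$ is a (coherent) $\{H\}_M$-UH graph if, for each copy $H_0$ of $H$ induced in $G$ and containing a copy $M_0$ of $M$, there exists exactly one copy $H_1\neq H_0$ of $H$ induced in $G$ such that $V(H_0)\cap V(H_1)=V(M_0)$ and $E(H_0)\cap E(H_1)=E(M_0)$. If $G$ is coherent $\{H\}_M$-UH and $K$ is both a subgraph of $H$ and a supergraph of $M$, then $G$ is $\{K\not\subset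 H\}_M$-UH if every isomorphism between two induced copies of $K$ in $G$ not contained in any copy of $H$ in $G$ extends to an automorphism of $G$. If, under these conditions, each copy of $M$ induced in $G$ coincides with the intersection of exactly one copy of $H$ and exactly one copy of $K$ not contained in any copy of $H$, then $G$ is coherent $\{H,K\}_M$-UH. Here $H=K_4$, $K=K_3$, $M=K_2$. **Configurations.** The Levi graph of a configuration is the bipartite incidence graph of its points and lines. The Menger graph of a self-dual configuration has its points as vertices, any two of them determining an edge if and only if they are collinear in the configuration.
   Formalization: In "coherent {K4,K3}_{K2}-UH" the inherited {H}_M clause, that each K4 containing an edge meets exactly one other K4 in just that edge, is dropped: it is false in L(K5), where distinct K4's share one vertex, and it contradicts the clause on exactly one K4 and one K3 per edge. -}

module Defs where

open import Data.Bool using (Bool; T)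
open import Data.Empty using (⊥)
open import Data.Fin using (Fin; combine; toℕ; _≟_)
open import Data.Fin.Patterns using (0F; 1F; 2F; 3F)
open import Data.Fin.Properties using (all?; any?)
open import Data.Nat using (ℕ; suc; _+_)
open import Data.Nat.DivMod using (_mod_)
open import Data.Product using (Σ; Σ-syntax; ∃; ∃-syntax; _×_; _,_; proj₁; proj₂)
open import Data.Sum using (_⊎_; inj₁; inj₂)
open import Data.Sum.Relation.Binary.Pointwise using (_⊎ₛ_; inj₁; inj₂)
open import Data.Vec using (Vec; []; _∷_; lookup)
open import Function using (_∘_; flip)
open import Function.Bundles using (Func; Inverse; _⇔_)
open import Level using (0ℓ)
open import Relation.Binary using (Rel; REL; Setoid)
open import Relation.Binary.Construct.Closure.ReflexiveTransitive using (Star)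
open import Relation.Binary.Construct.Closure.Symmetric using (SymClosure; fwd; bwd; symmetric)
import Relation.Binary.Construct.On as On
open import Relation.Binary.PropositionalEquality
  using (_≡_; _≢_; refl; sym; trans; cong; subst; setoid; ≢-sym)
open import Relation.Nullary using (¬_; Dec)
open import Relation.Nullary.Decidable using (isYes; from-yes; ¬?; _⊎-dec_)

-- The vertices form a setoid because some of the vertex sets below (the
-- edges of a graph, the copies of a graph in another one) are quotients.
record Graph : Set₁ where
  field
    vertices : Setoid 0ℓ 0ℓ
  open Setoid vertices public using (_≈_) renaming (Carrier to V)
  field
    Adj         : Rel V 0ℓ
    symmetricᴬ  : ∀ {u v} → Adj u v → Adj v u
    irreflexive : ∀ {u v} → u ≈ v → ¬ Adj u v
    respects    : ∀ {u u′ v v′} → u ≈ u′ → v ≈ v′ → Adj u v → Adj u′ v′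

open Graph using (V; vertices)

infix 4 _≅_

record _≅_ (G H : Graph) : Set where
  field
    bijection : Inverse (vertices G) (vertices H)
  open Inverse bijection public using (to; from)
  field
    adjacency : ∀ u v → Graph.Adj G u v ⇔ Graph.Adj H (to u) (to v)

HasSize : Setoid 0ℓ 0ℓ → ℕ → Set
HasSize S n = Inverse S (setoid (Fin n))

graph : {A : Set} (_~_ : Rel A 0ℓ) → (∀ {u v} → u ~ v → v ~ u) →
        (∀ u → ¬ (u ~ u)) → Graph
graph {A} _~_ ~-sym ~-irr = record
  { vertices    = setoid A
  ; Adj         = _~_
  ; symmetricᴬ  = ~-sym
  ; irreflexive = λ { refl → ~-irr _ }
  ; respects    = λ { refl refl a → a }
  }

K : ℕ → Graph
K n = graph {Fin n} _≢_ ≢-sym (λ _ u≢u → u≢u refl)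

complement : Graph → Graph
complement G = record
  { vertices    = vertices G
  ; Adj         = λ u v → ¬ (u ≈ v) × ¬ Adj u v
  ; symmetricᴬ  = λ (u≉v , ¬a) → u≉v ∘ S.sym , ¬a ∘ symmetricᴬ
  ; irreflexive = λ u≈v (u≉v , _) → u≉v u≈v
  ; respects    = λ p q (u≉v , ¬a) →
      (λ r → u≉v (S.trans p (S.trans r (S.sym q)))) ,
      (λ a → ¬a (respects (S.sym p) (S.sym q) a))
  }
  where
  open Graph G hiding (vertices)
  module S = Setoid (vertices G)

module _ (G : Graph) where
  open Graph G using (Adj; _≈_; symmetricᴬ)
  private module S = Setoid (vertices G)

  Edge : Set
  Edge = Σ[ (u , v) ∈ V G × V G ] Adj u v

  edges : Setoid 0ℓ 0ℓ
  edges = record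
    { Carrier = Edge
    ; _≈_ = λ { ((u , v) , _) ((u′ , v′) , _) →
              (u ≈ u′ × v ≈ v′) ⊎ (u ≈ v′ × v ≈ u′) }
    ; isEquivalence = record
      { refl  = inj₁ (S.refl , S.refl)
      ; sym   = λ { (inj₁ (p , q)) → inj₁ (S.sym p , S.sym q)
                  ; (inj₂ (p , q)) → inj₂ (S.sym q , S.sym p) }
      ; trans = λ { (inj₁ (p , q)) (inj₁ (r , s)) → inj₁ (S.trans p r , S.trans q s)
                  ; (inj₁ (p , q)) (inj₂ (r , s)) → inj₂ (S.trans p r , S.trans q s)
                  ; (inj₂ (p , q)) (inj₁ (r , s)) → inj₂ (S.trans p s , S.trans q r)
                  ; (inj₂ (p , q)) (inj₂ (r , s)) → inj₁ (S.trans p s , S.trans q r) }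
      }
    }

  EndOf : V G → Edge → Set
  EndOf w ((u , v) , _) = w ≈ u ⊎ w ≈ v

  private
    EndOf-resp : ∀ {w e f} → Setoid._≈_ edges e f → EndOf w e → EndOf w f
    EndOf-resp (inj₁ (p , q)) (inj₁ r) = inj₁ (S.trans r p)
    EndOf-resp (inj₁ (p , q)) (inj₂ r) = inj₂ (S.trans r q)
    EndOf-resp (inj₂ (p , q)) (inj₁ r) = inj₂ (S.trans r p)
    EndOf-resp (inj₂ (p , q)) (inj₂ r) = inj₁ (S.trans r q)

  lineGraph : Graph
  lineGraph = record
    { vertices    = edges
    ; Adj         = λ e f → ¬ (Setoid._≈_ edges e f) × ∃[ w ] (EndOf w e × EndOf w f)
    ; symmetricᴬ  = λ {e} {f} (e≉f , w , p , q) → (λ r → e≉f (E.sym {f} {e} r)) , w , q , p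
    ; irreflexive = λ e≈f (e≉f , _) → e≉f e≈f
    ; respects    = λ {e} {e′} {f} {f′} p q (e≉f , w , r , s) →
        (λ t → e≉f (E.trans {e} {e′} {f} p (E.trans {e′} {f′} {f} t (E.sym {f} {f′} q)))) ,
        w , EndOf-resp {w} {e} {e′} p r , EndOf-resp {w} {f} {f′} q s
    }
    where module E = Setoid edges

module _ (G : Graph) where
  open Graph G using (Adj; _≈_; symmetricᴬ; irreflexive; respects)

  VertexSet : Set
  VertexSet = Func (vertices G) (setoid Bool)

  infix 4 _∈ᵛ_

  _∈ᵛ_ : V G → VertexSet → Set
  v ∈ᵛ S = T (Func.to S v)

  induced : VertexSet → Graph
  induced S = record
    { vertices    = On.setoid {B = ∃[ v ] v ∈ᵛ S} (vertices G) proj₁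
    ; Adj         = λ (u , _) (v , _) → Adj u v
    ; symmetricᴬ  = symmetricᴬ
    ; irreflexive = irreflexive
    ; respects    = respects
    }

  EdgeIn : VertexSet → V G → V G → Set
  EdgeIn S u v = u ∈ᵛ S × v ∈ᵛ S × Adj u v

  Reachable : Rel (V G) 0ℓ
  Reachable u v = ∃[ w ] (Star Adj u w × w ≈ v)

  IsComponent : VertexSet → Set
  IsComponent S =
    (∃[ v ] v ∈ᵛ S) × (∀ u v → u ∈ᵛ S → (v ∈ᵛ S ⇔ Reachable u v))

  -- A copy of H induced in G is an induced subgraph of G isomorphic to H.
  -- Copies are compared by their vertex sets: the isomorphism is not part
  -- of the identity of a copy.
  Copy : Graph → Set
  Copy H = Σ[ S ∈ VertexSet ] induced S ≅ H

  vertexSets : Setoid 0ℓ 0ℓ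
  vertexSets = record
    { Carrier = VertexSet
    ; _≈_ = λ S S′ → ∀ v → Func.to S v ≡ Func.to S′ v
    ; isEquivalence = record
      { refl  = λ _ → refl
      ; sym   = λ p v → sym (p v)
      ; trans = λ p q v → trans (p v) (q v)
      }
    }

  _ContainedIn_ : VertexSet → VertexSet → Set
  S ContainedIn S′ = ∀ v → v ∈ᵛ S → v ∈ᵛ S′

  NotInAnyCopyOf : Graph → VertexSet → Set
  NotInAnyCopyOf H S = ¬ (Σ[ (H₀ , _) ∈ Copy H ] S ContainedIn H₀)

  CopyOutside : Graph → Graph → Set
  CopyOutside K H = Σ[ (K₀ , _) ∈ Copy K ] NotInAnyCopyOf H K₀

  copies : Graph → Setoid 0ℓ 0ℓ
  copies H = On.setoid {B = Copy H} vertexSets proj₁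

  copiesOutside : Graph → Graph → Setoid 0ℓ 0ℓ
  copiesOutside K H = On.setoid {B = CopyOutside K H} vertexSets (proj₁ ∘ proj₁)

  MeetExactlyIn : VertexSet → VertexSet → VertexSet → Set
  MeetExactlyIn S S′ M =
    (∀ v → (v ∈ᵛ S × v ∈ᵛ S′) ⇔ v ∈ᵛ M) ×
    (∀ u v → (EdgeIn S u v × EdgeIn S′ u v) ⇔ EdgeIn M u v)

Subgraph : Graph → Graph → Set
Subgraph K H = Σ[ f ∈ Func (vertices K) (vertices H) ]
  (∀ u v → Graph._≈_ H (Func.to f u) (Func.to f v) → Graph._≈_ K u v) ×
  (∀ u v → Graph.Adj K u v → Graph.Adj H (Func.to f u) (Func.to f v))

ExtendsToAutomorphism : (G : Graph) (S S′ : VertexSet G) →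
                        induced G S ≅ induced G S′ → Set
ExtendsToAutomorphism G S S′ f =
  Σ[ α ∈ G ≅ G ] (∀ s → Graph._≈_ G (proj₁ (_≅_.to f s)) (_≅_.to α (proj₁ s)))

Ultrahomogeneous : Graph → Graph → Set
Ultrahomogeneous H G =
  ((S , _) (S′ , _) : Copy G H) (f : induced G S ≅ induced G S′) →
  ExtendsToAutomorphism G S S′ f

-- {K ⊄ H}-ultrahomogeneity
UltrahomogeneousOutside : Graph → Graph → Graph → Set
UltrahomogeneousOutside K H G =
  (((S , _) , _) ((S′ , _) , _) : CopyOutside G K H) (f : induced G S ≅ induced G S′) →
  ExtendsToAutomorphism G S S′ f

-- Coherent {H,K}_M-ultrahomogeneity.  The pairing of the copies through M
-- is between a copy of H and a copy of K (`meets`).  The clause of coherent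
-- {H}_M-ultrahomogeneity that pairs each copy H₀ ⊇ M₀ of H with a second
-- copy H₁ of H such that H₀ ∩ H₁ = M₀ is not a field: for K₄, K₃, K₂ it
-- contradicts `meets` in every graph with an edge M₀, as a triangle K₀
-- outside all K₄'s and meeting H₀ in M₀ would also meet H₁ in M₀ (in L(K₅)
-- distinct K₄'s share a single vertex).
record Coherent (H K M G : Graph) : Set where
  field
    M⊆H  : Copy H M
    K⊆H  : Subgraph K H
    M⊆K  : Subgraph M K
    M-UH : Ultrahomogeneous M G
    H-UH : Ultrahomogeneous H G
    K-UH : UltrahomogeneousOutside K H G
    meets : ((M₀ , _) : Copy G M) →
      Σ[ h@(H₀ , _) ∈ Copy G H ] Σ[ k@((K₀ , _) , _) ∈ CopyOutside G K H ]
        MeetExactlyIn G H₀ K₀ M₀ ×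
        ((h′@(H₁ , _) : Copy G H) (k′@((K₁ , _) , _) : CopyOutside G K H) →
          MeetExactlyIn G H₁ K₁ M₀ →
          Setoid._≈_ (copies G H) h h′ × Setoid._≈_ (copiesOutside G K H) k k′)

-- G is the union of m copies of H, and also the union of n copies of K not
-- contained in a copy of H, these being all such copies in G.
record ComposedOf (m : ℕ) (H : Graph) (n : ℕ) (K : Graph) (G : Graph) : Set where
  field
    #H : HasSize (copies G H) m
    #K : HasSize (copiesOutside G K H) n
    vertices-H : ∀ v → Σ[ (H₀ , _) ∈ Copy G H ] _∈ᵛ_ G v H₀
    vertices-K : ∀ v → Σ[ ((K₀ , _) , _) ∈ CopyOutside G K H ] _∈ᵛ_ G v K₀
    edges-H : ∀ u v → Graph.Adj G u v → Σ[ (H₀ , _) ∈ Copy G H ] EdgeIn G H₀ u v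
    edges-K : ∀ u v → Graph.Adj G u v →
              Σ[ ((K₀ , _) , _) ∈ CopyOutside G K H ] EdgeIn G K₀ u v

record Incidence : Set₁ where
  field
    points lines : Setoid 0ℓ 0ℓ
  open Setoid points public using () renaming (Carrier to Point; _≈_ to _≈ᵖ_)
  open Setoid lines  public using () renaming (Carrier to Line;  _≈_ to _≈ˡ_)
  field
    _on_ : REL Point Line 0ℓ
    on-resp : ∀ {p p′ ℓ ℓ′} → p ≈ᵖ p′ → ℓ ≈ˡ ℓ′ → p on ℓ → p′ on ℓ′

  linesThrough : Point → Setoid 0ℓ 0ℓ
  linesThrough p = On.setoid {B = ∃[ ℓ ] p on ℓ} lines proj₁

  pointsOn : Line → Setoid 0ℓ 0ℓ
  pointsOn ℓ = On.setoid {B = ∃[ p ] p on ℓ} points proj₁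

  Collinear : Rel Point 0ℓ
  Collinear p q = ∃[ ℓ ] (p on ℓ × q on ℓ)

-- (n_r) configuration
record IsConfiguration (n r : ℕ) (C : Incidence) : Set where
  open Incidence C
  field
    #points   : HasSize points n
    #lines    : HasSize lines n
    #through  : ∀ p → HasSize (linesThrough p) r
    #on       : ∀ ℓ → HasSize (pointsOn ℓ) r
    ≤1-common : ∀ {p q ℓ ℓ′} → ¬ (p ≈ᵖ q) →
                p on ℓ → q on ℓ → p on ℓ′ → q on ℓ′ → ℓ ≈ˡ ℓ′

infix 4 _≅ᶜ_

record _≅ᶜ_ (C D : Incidence) : Set where
  private
    module C = Incidence C
    module D = Incidence D
  field
    on-points : Inverse C.points D.points
    on-lines  : Inverse C.lines D.lines
    incidence : ∀ p ℓ → p C.on ℓ ⇔ (Inverse.to on-points p D.on Inverse.to on-lines ℓ)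

dual : Incidence → Incidence
dual C = record
  { points  = lines
  ; lines   = points
  ; _on_    = flip _on_
  ; on-resp = λ p q → on-resp q p
  }
  where open Incidence C

SelfDual : Incidence → Set
SelfDual C = C ≅ᶜ dual C

levi : Incidence → Graph
levi C = record
  { vertices    = points ⊎ₛ lines
  ; Adj         = _~_
  ; symmetricᴬ  = λ {u} {v} → ~-sym u v
  ; irreflexive = ~-irr
  ; respects    = ~-resp
  }
  where
  open Incidence C
  _~_ : Rel (Point ⊎ Line) 0ℓ
  inj₁ p ~ inj₂ ℓ = p on ℓ
  inj₂ ℓ ~ inj₁ p = p on ℓ
  inj₁ _ ~ inj₁ _ = ⊥
  inj₂ _ ~ inj₂ _ = ⊥

  ~-sym : ∀ u v → u ~ v → v ~ u
  ~-sym (inj₁ _) (inj₂ _) i = i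
  ~-sym (inj₂ _) (inj₁ _) i = i

  ~-irr : ∀ {u v} → Setoid._≈_ (points ⊎ₛ lines) u v → ¬ (u ~ v)
  ~-irr (inj₁ _) ()
  ~-irr (inj₂ _) ()

  ~-resp : ∀ {u u′ v v′} → Setoid._≈_ (points ⊎ₛ lines) u u′ →
           Setoid._≈_ (points ⊎ₛ lines) v v′ → u ~ v → u′ ~ v′
  ~-resp (inj₁ p) (inj₂ q) i = on-resp p q i
  ~-resp (inj₂ q) (inj₁ p) i = on-resp p q i

menger : Incidence → Graph
menger C = record
  { vertices    = points
  ; Adj         = λ p q → ¬ (p ≈ᵖ q) × Collinear p q
  ; symmetricᴬ  = λ (p≉q , ℓ , i , j) → p≉q ∘ P.sym , ℓ , j , i
  ; irreflexive = λ p≈q (p≉q , _) → p≉q p≈q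
  ; respects    = λ p≈ q≈ (p≉q , ℓ , i , j) →
      (λ r → p≉q (P.trans p≈ (P.trans r (P.sym q≈)))) ,
      ℓ , on-resp p≈ L.refl i , on-resp q≈ L.refl j
  }
  where
  open Incidence C
  module P = Setoid points
  module L = Setoid lines

-- Points: the vertices of G.  Lines: the copies of K in G not contained in a
-- copy of H.
copyConfiguration : (K H G : Graph) → Incidence
copyConfiguration K H G = record
  { points  = vertices G
  ; lines   = copiesOutside G K H
  ; _on_    = λ { v ((K₀ , _) , _) → _∈ᵛ_ G v K₀ }
  ; on-resp = λ { {p} {p′} {(S , _) , _} {(S′ , _) , _} p≈p′ S≈S′ →
                  subst T (trans (Func.cong S p≈p′) (S≈S′ p′)) }
  }

-- The configuration of Desargues' theorem: the triangles a 0 a 1 a 2 and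
-- b 0 b 1 b 2 are in perspective from the centre; side a j and side b j are
-- their sides opposite to a j and b j, and these meet at c j on the axis.
module Desargues where

  data Point : Set where
    centre : Point
    a b c  : Fin 3 → Point

  data Line : Set where
    ray sideA sideB : Fin 3 → Line
    axis            : Line

  data _on_ : REL Point Line 0ℓ where
    centre-ray : ∀ j → centre on ray j
    a-ray      : ∀ j → a j on ray j
    b-ray      : ∀ j → b j on ray j
    a-sideA    : ∀ {i j} → i ≢ j → a i on sideA j
    b-sideB    : ∀ {i j} → i ≢ j → b i on sideB j
    c-sideA    : ∀ j → c j on sideA j
    c-sideB    : ∀ j → c j on sideB j
    c-axis     : ∀ j → c j on axis

desarguesConfiguration : Incidence
desarguesConfiguration = record
  { points  = setoid Desargues.Point
  ; lines   = setoid Desargues.Line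
  ; _on_    = Desargues._on_
  ; on-resp = λ { refl refl i → i }
  }

infixl 6 _⊕_

_⊕_ : ∀ {n} → Fin (suc n) → ℕ → Fin (suc n)
_⊕_ {n} i k = (toℕ i + k) mod suc n

module Petersen where

  data Vertex : Set where
    outer inner : Fin 5 → Vertex

  data Link : Rel Vertex 0ℓ where
    pentagon  : ∀ i → Link (outer i) (outer (i ⊕ 1))
    spoke     : ∀ i → Link (outer i) (inner i)
    pentagram : ∀ i → Link (inner i) (inner (i ⊕ 2))

  private
    shift1 : ∀ (i : Fin 5) → i ≢ i ⊕ 1
    shift1 = from-yes (all? λ (i : Fin 5) → ¬? (i ≟ i ⊕ 1))

    shift2 : ∀ (i : Fin 5) → i ≢ i ⊕ 2
    shift2 = from-yes (all? λ (i : Fin 5) → ¬? (i ≟ i ⊕ 2))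

    distinct : ∀ {u v} → Link u v → u ≢ v
    distinct (pentagon i) e = shift1 i (outer-inj e)
      where outer-inj : ∀ {i j} → outer i ≡ outer j → i ≡ j
            outer-inj refl = refl
    distinct (pentagram i) e = shift2 i (inner-inj e)
      where inner-inj : ∀ {i j} → inner i ≡ inner j → i ≡ j
            inner-inj refl = refl

  petersen : Graph
  petersen = graph (SymClosure Link) (symmetric Link)
    λ { u (fwd e) → distinct e refl ; u (bwd e) → distinct e refl }

open Petersen public using (petersen)

infix 8 _₀ _₁ _₂ _₃

-- combine x j is 4x + j, so x ₀, …, x ₃ are the vertices 4x, …, 4x+3 of the
-- 20-cycle.
_₀ _₁ _₂ _₃ : Fin 5 → Fin 20
x ₀ = combine {5} {4} x 0F
x ₁ = combine {5} {4} x 1F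
x ₂ = combine {5} {4} x 2F
x ₃ = combine {5} {4} x 3F

data Link : Rel (Fin 20) 0ℓ where
  cycle   : ∀ i → Link i (i ⊕ 1)
  chord₃₀ : ∀ x → Link (x ₃) ((x ⊕ 2) ₀)
  chord₁₂ : ∀ x → Link (x ₁) ((x ⊕ 2) ₂)

private
  Link-distinct : ∀ {u v} → Link u v → u ≢ v
  Link-distinct (cycle i)   = from-yes (all? λ (i : Fin 20) → ¬? (i ≟ i ⊕ 1)) i
  Link-distinct (chord₃₀ x) = from-yes (all? λ x → ¬? (x ₃ ≟ (x ⊕ 2) ₀)) x
  Link-distinct (chord₁₂ x) = from-yes (all? λ x → ¬? (x ₁ ≟ (x ⊕ 2) ₂)) x

𝒟 : Graph
𝒟 = graph (SymClosure Link) (symmetric Link)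
  λ { u (fwd e) → Link-distinct e refl ; u (bwd e) → Link-distinct e refl }

data Family : Set where
  A B C D : Family

hexagon : Family → Fin 5 → Vec (Fin 20) 6
hexagon A x = x ₀ ∷ x ₁ ∷ x ₂ ∷ x ₃ ∷ (x ⊕ 1) ₀ ∷ (x ⊕ 4) ₃ ∷ []
hexagon B x = x ₁ ∷ x ₀ ∷ (x ⊕ 4) ₃ ∷ (x ⊕ 4) ₂ ∷ (x ⊕ 2) ₁ ∷ (x ⊕ 2) ₂ ∷ []
hexagon C x = x ₂ ∷ x ₁ ∷ x ₀ ∷ (x ⊕ 3) ₃ ∷ (x ⊕ 3) ₂ ∷ (x ⊕ 3) ₁ ∷ []
hexagon D x = x ₀ ∷ (x ⊕ 4) ₃ ∷ (x ⊕ 1) ₀ ∷ (x ⊕ 1) ₁ ∷ (x ⊕ 3) ₂ ∷ (x ⊕ 3) ₃ ∷ []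

-- An arc (u , v) of the square of an oriented 6-cycle c, together with the
-- 2-path u w v of c from which it arises.
SquareArc : Vec (Fin 20) 6 → (u w v : Fin 20) → Set
SquareArc c u w v =
  ∃[ i ] (lookup c i ≡ u × lookup c (i ⊕ 1) ≡ w × lookup c (i ⊕ 2) ≡ v)

-- (u , v) and (v , u) are a pair of arcs arising from opposite traversals of
-- a common 2-path.
OppositeArcs : Rel (Fin 20) 0ℓ
OppositeArcs u v = ∃[ w ]
  ((∃[ F ] ∃[ x ] SquareArc (hexagon F x) u w v) ×
   (∃[ F ] ∃[ x ] SquareArc (hexagon F x) v w u))

private
  noLoop : ∀ F x i → lookup (hexagon F x) i ≢ lookup (hexagon F x) (i ⊕ 2)
  noLoop A = from-yes (all? λ x → all? λ i → ¬? (lookup (hexagon A x) i ≟ lookup (hexagon A x) (i ⊕ 2)))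
  noLoop B = from-yes (all? λ x → all? λ i → ¬? (lookup (hexagon B x) i ≟ lookup (hexagon B x) (i ⊕ 2)))
  noLoop C = from-yes (all? λ x → all? λ i → ¬? (lookup (hexagon C x) i ≟ lookup (hexagon C x) (i ⊕ 2)))
  noLoop D = from-yes (all? λ x → all? λ i → ¬? (lookup (hexagon D x) i ≟ lookup (hexagon D x) (i ⊕ 2)))

Y : Graph
Y = graph OppositeArcs
  (λ (w , uwv , vwu) → w , vwu , uwv)
  (λ { u (_ , (F , x , i , p , _ , q) , _) → noLoop F x i (trans p (sym q)) })

vertexSetY : {P : Fin 20 → Set} → (∀ v → Dec (P v)) → VertexSet Y
vertexSetY P? = record { to = λ v → isYes (P? v) ; cong = cong (λ v → isYes (P? v)) }

part₁ part₂ : VertexSet Y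
part₁ = vertexSetY λ v → any? λ x → (v ≟ x ₀) ⊎-dec (v ≟ x ₂)
part₂ = vertexSetY λ v → any? λ x → (v ≟ x ₁) ⊎-dec (v ≟ x ₃)

Y₁ Y₂ : Graph
Y₁ = induced Y part₁
Y₂ = induced Y part₂

{-# OPTIONS --safe #-}

-- The line graph J of K₅ is the complement of the Petersen graph, whose
-- vertices are read as the pairs in Fin 5, disjoint pairs being adjacent.  The
-- K₄'s of J are the five stars of K₅; its other K₃'s are the ten triangles of
-- K₅, named after their complementary pairs.  So a point lies on a line exactly
-- when their pairs are disjoint: the configuration is self-dual and its Levi
-- graph is the bipartite double of the Petersen graph.  The permutations of
-- Fin 5 act on J, and they move a fixed ordered K₂, K₄ or triangle to all the
-- others, which is ultrahomogeneity.  These facts about J are finite checks;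
-- everything transports along isomorphisms of Y₁ and Y₂ with J.
module Submission where

open import Defs
open import Data.Bool using (T)
open import Data.Bool.Properties using (⇔→≡; T-≡)
open import Data.Fin using (Fin; suc; _≟_; inject₁; _↑ˡ_)
open import Data.Fin.Patterns using (0F; 1F; 2F; 3F; 4F)
open import Data.Fin.Permutation as Permutation using (Permutation′; insert)
open import Data.Fin.Properties using (all?; any?; +↔⊎; inject₁-injective; ↑ˡ-injective)
open import Data.List using (_∷_; [])
open import Data.List.Relation.Unary.All using (All; _∷_; [])
open import Data.Nat using (ℕ; suc; _+_)
open import Data.Product using (Σ-syntax; ∃; ∃-syntax; _×_; _,_; proj₁; proj₂; map; uncurry)
open import Data.Sum using (_⊎_; inj₁; inj₂; [_,_]; [_,_]′) renaming (map to map⊎)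
open import Data.Sum.Function.Setoid using (_⊎-inverse_)
open import Data.Sum.Relation.Binary.Pointwise using (inj₁; inj₂)
open import Data.Vec using (Vec; []; _∷_; lookup; tabulate)
open import Data.Vec.Membership.Propositional.Properties using (∈-lookup)
open import Data.Vec.Properties using (lookup∘tabulate)
open import Data.Vec.Relation.Binary.Pointwise.Inductive as Pointwise using (Pointwise)
open import Data.Vec.Relation.Unary.All as Allᵛ using () renaming (All to Allᵛ)
import Data.Vec.Relation.Unary.All.Properties as Allₚ
open import Data.Vec.Relation.Unary.AllPairs using (AllPairs; []; _∷_; allPairs?)
import Data.Vec.Relation.Unary.AllPairs.Properties as AllPairsₚ
open import Data.Vec.Relation.Unary.Any using (index)
open import Data.Vec.Relation.Unary.Any.Properties using (tabulate⁺; tabulate⁻; lookup-index)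
open import Function using (_∘_; id)
open import Function.Bundles using (Func; Inverse; Equivalence; _⇔_; mk⇔; mk↔ₛ′)
import Function.Construct.Composition as Composition
import Function.Construct.Identity as Identity
import Function.Construct.Symmetry as Symmetry
open import Function.Properties.Equivalence using () renaming (sym to ⇔-sym; trans to ⇔-trans)
open import Level using (0ℓ)
open import Relation.Binary using (Setoid; Decidable; DecidableEquality; _Respects_)
open import Relation.Binary.Construct.Closure.ReflexiveTransitive using (Star; ε; _◅_)
open import Relation.Binary.Construct.Closure.Symmetric using (SymClosure; fwd; bwd; symmetric)
import Relation.Binary.Construct.On as On
open import Relation.Binary.PropositionalEquality
  using (_≡_; _≢_; refl; sym; trans; cong; subst; subst₂; setoid)
open import Relation.Nullary using (¬_; Dec; yes; no; contradiction)
open import Relation.Nullary.Decidable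
  using (map′; from-yes; ¬?; _×-dec_; _⊎-dec_; _→-dec_; T?; isYes; toWitness; fromWitness; decidable-stable)
open import Relation.Unary using (Pred) renaming (Decidable to Decidable₁)

open Petersen using (Vertex; outer; inner; pentagon; spoke; pentagram)
open Equivalence using () renaming (to to ⇒; from to ⇐)


-- Bijections of setoids.

module _ {S T : Setoid 0ℓ 0ℓ} where
  private
    module S = Setoid S
    module T = Setoid T

  -- Preimages are chosen without regard to `≈`; injectivity makes the choice respect it and turns
  -- it into a two-sided inverse.
  bijective⇒inverse : (f : Func S T) →
    (∀ {x y} → Func.to f x T.≈ Func.to f y → x S.≈ y) →
    (∀ y → ∃[ x ] Func.to f x T.≈ y) → Inverse S T
  bijective⇒inverse f injective surjective = record
    { to        = to
    ; from      = from
    ; to-cong   = Func.cong f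
    ; from-cong = λ y≈z → injective (T.trans to∘from (T.trans y≈z (T.sym to∘from)))
    ; inverse   = (λ x≈ → T.trans (Func.cong f x≈) to∘from)
                , (λ y≈ → injective (T.trans to∘from y≈))
    }
    where
    open Func f using (to)
    from : T.Carrier → S.Carrier
    from y = proj₁ (surjective y)
    to∘from : ∀ {y} → to (from y) T.≈ y
    to∘from {y} = proj₂ (surjective y)

  restrict : {P : Pred S.Carrier 0ℓ} {Q : Pred T.Carrier 0ℓ} (f : Inverse S T) →
    (∀ x → P x ⇔ Q (Inverse.to f x)) → Q Respects T._≈_ →
    Inverse (On.setoid {B = ∃ P} S proj₁) (On.setoid {B = ∃ Q} T proj₁)
  restrict f P⇔Q Q-resp = record
    { to        = λ (x , px) → to x , ⇒ (P⇔Q x) px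
    ; from      = λ (y , qy) → from y , ⇐ (P⇔Q _) (Q-resp (T.sym (strictlyInverseˡ y)) qy)
    ; to-cong   = λ e → to-cong e
    ; from-cong = λ e → from-cong e
    ; inverse   = (λ e → inverseˡ e) , (λ e → inverseʳ e)
    }
    where open Inverse f

enumeration : {A : Set} (S : Setoid 0ℓ 0ℓ) (let open Setoid S) (e : A → Carrier) →
  (∀ {a b} → e a ≈ e b → a ≡ b) → (∀ s → ∃[ a ] e a ≈ s) → Inverse S (setoid A)
enumeration S e injective surjective = Symmetry.inverse
  (bijective⇒inverse (record { to = e ; cong = λ { refl → Setoid.refl S } }) injective surjective)

-- Isomorphisms of graphs, of their complements and of their line graphs.

module _ {G H : Graph} where
  private
    module G = Setoid (Graph.vertices G)
    module H = Setoid (Graph.vertices H)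

  injectiveᴳ : (φ : G ≅ H) → ∀ {u v} → _≅_.to φ u H.≈ _≅_.to φ v → u G.≈ v
  injectiveᴳ φ e = G.trans (G.sym (strictlyInverseʳ _)) (G.trans (from-cong e) (strictlyInverseʳ _))
    where open Inverse (_≅_.bijection φ)

  ≉-cong : (φ : G ≅ H) → ∀ u v → (¬ u G.≈ v) ⇔ (¬ _≅_.to φ u H.≈ _≅_.to φ v)
  ≉-cong φ u v = mk⇔ (_∘ injectiveᴳ φ) (_∘ Inverse.to-cong (_≅_.bijection φ))

  ≅-sym : G ≅ H → H ≅ G
  ≅-sym φ = record
    { bijection = Symmetry.inverse bijection
    ; adjacency = λ u v → mk⇔
        (⇐ (adjacency _ _) ∘ Graph.respects H (H.sym (to∘from u)) (H.sym (to∘from v)))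
        (Graph.respects H (to∘from u) (to∘from v) ∘ ⇒ (adjacency _ _))
    }
    where
    open _≅_ φ
    to∘from = Inverse.strictlyInverseˡ bijection

  complement-cong : G ≅ H → complement G ≅ complement H
  complement-cong φ = record
    { bijection = bijection
    ; adjacency = λ u v → mk⇔
        (map (⇒ (≉-cong φ u v)) (_∘ ⇐ (adjacency u v)))
        (map (⇐ (≉-cong φ u v)) (_∘ ⇒ (adjacency u v)))
    }
    where open _≅_ φ

  lineGraph-cong : G ≅ H → lineGraph G ≅ lineGraph H
  lineGraph-cong φ = record
    { bijection = edge-bijection
    ; adjacency = λ { e@((u , v) , _) f@((u′ , v′) , _) → mk⇔
        (λ (e≉f , w , w∈e , w∈f) → e≉f ∘ edge-injective {e} {f}
          , to w , map⊎ to-cong to-cong w∈e , map⊎ to-cong to-cong w∈f)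
        (λ (e≉f , w , w∈e , w∈f) → e≉f ∘ to-cong-edge {e} {f}
          , from w , map⊎ inverseʳ inverseʳ w∈e , map⊎ inverseʳ inverseʳ w∈f) }
    }
    where
    open _≅_ φ using (bijection; adjacency)
    open Inverse bijection
    module E = Setoid (edges G)
    module F = Setoid (edges H)

    edge-to : E.Carrier → F.Carrier
    edge-to ((u , v) , a) = (to u , to v) , ⇒ (adjacency u v) a

    to-cong-edge : ∀ {e f} → e E.≈ f → edge-to e F.≈ edge-to f
    to-cong-edge = map⊎ (map to-cong to-cong) (map to-cong to-cong)

    edge-injective : ∀ {e f} → edge-to e F.≈ edge-to f → e E.≈ f
    edge-injective = map⊎ (map (injectiveᴳ φ) (injectiveᴳ φ)) (map (injectiveᴳ φ) (injectiveᴳ φ))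

    edge-bijection : Inverse (edges G) (edges H)
    edge-bijection = bijective⇒inverse
      (record { to = edge-to ; cong = λ {e} {f} → to-cong-edge {e} {f} })
      (λ {e} {f} → edge-injective {e} {f})
      (λ { ((u , v) , a) → ((from u , from v) , ⇒ (_≅_.adjacency (≅-sym φ) u v) a)
                         , inj₁ (strictlyInverseˡ u , strictlyInverseˡ v) })

≅-trans : {F G H : Graph} → F ≅ G → G ≅ H → F ≅ H
≅-trans φ ψ = record
  { bijection = Composition.inverse (_≅_.bijection φ) (_≅_.bijection ψ)
  ; adjacency = λ u v → ⇔-trans (_≅_.adjacency φ u v) (_≅_.adjacency ψ _ _)
  }

complement-involutive : (G : Graph) → Decidable (Graph.Adj G) → complement (complement G) ≅ G
complement-involutive G adj? = record
  { bijection = Identity.inverse (Graph.vertices G)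
  ; adjacency = λ u v → mk⇔
      (λ (u≉v , ¬¬a) → decidable-stable (adj? u v) (λ ¬a → ¬¬a (u≉v , ¬a)))
      (λ a → (λ u≈v → Graph.irreflexive G u≈v a) , (λ (_ , ¬a) → ¬a a))
  }

K-cong : ∀ {n} → Permutation′ n → K n ≅ K n
K-cong π = record
  { bijection = π
  ; adjacency = λ u v → mk⇔
      (_∘ λ e → trans (sym (strictlyInverseʳ u)) (trans (cong from e) (strictlyInverseʳ v)))
      (_∘ cong to)
  }
  where open Inverse π

-- Isomorphisms of incidence structures and the properties they preserve.

module _ {C D : Incidence} where
  private
    module C = Incidence C
    module D = Incidence D
    module Dᵖ = Setoid D.points
    module Dˡ = Setoid D.lines

  ≅ᶜ-sym : C ≅ᶜ D → D ≅ᶜ C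
  ≅ᶜ-sym φ = record
    { on-points = Symmetry.inverse on-points
    ; on-lines  = Symmetry.inverse on-lines
    ; incidence = λ p ℓ → mk⇔
        (⇐ (incidence _ _) ∘ D.on-resp (Dᵖ.sym (to∘fromᵖ p)) (Dˡ.sym (to∘fromˡ ℓ)))
        (D.on-resp (to∘fromᵖ p) (to∘fromˡ ℓ) ∘ ⇒ (incidence _ _))
    }
    where
    open _≅ᶜ_ φ
    to∘fromᵖ = Inverse.strictlyInverseˡ on-points
    to∘fromˡ = Inverse.strictlyInverseˡ on-lines

  dual-cong : C ≅ᶜ D → dual C ≅ᶜ dual D
  dual-cong φ = record
    { on-points = on-lines ; on-lines = on-points ; incidence = λ ℓ p → incidence p ℓ }
    where open _≅ᶜ_ φ

  levi-cong : C ≅ᶜ D → levi C ≅ levi D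
  levi-cong φ = record
    { bijection = on-points ⊎-inverse on-lines
    ; adjacency = λ
        { (inj₁ p) (inj₂ ℓ) → incidence p ℓ
        ; (inj₂ ℓ) (inj₁ p) → incidence p ℓ
        ; (inj₁ _) (inj₁ _) → mk⇔ id id
        ; (inj₂ _) (inj₂ _) → mk⇔ id id
        }
    }
    where open _≅ᶜ_ φ

  module _ (φ : C ≅ᶜ D) where
    open _≅ᶜ_ φ
    private
      module P = Inverse on-points
      module L = Inverse on-lines
      module Cᵖ = Setoid C.points
      module Cˡ = Setoid C.lines

      injectiveᵖ : ∀ {p q} → P.to p D.≈ᵖ P.to q → p C.≈ᵖ q
      injectiveᵖ e = Cᵖ.trans (Cᵖ.sym (P.strictlyInverseʳ _)) (P.inverseʳ e)

      injectiveˡ : ∀ {ℓ m} → L.to ℓ D.≈ˡ L.to m → ℓ C.≈ˡ m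
      injectiveˡ e = Cˡ.trans (Cˡ.sym (L.strictlyInverseʳ _)) (L.inverseʳ e)

      lift : ∀ {p ℓ} → P.to p D.on ℓ → p C.on L.from ℓ
      lift = ⇐ (incidence _ _) ∘ D.on-resp Dᵖ.refl (Dˡ.sym (L.strictlyInverseˡ _))

    menger-cong : menger C ≅ menger D
    menger-cong = record
      { bijection = on-points
      ; adjacency = λ p q → mk⇔
          (λ (p≉q , ℓ , i , j) → p≉q ∘ injectiveᵖ , L.to ℓ , ⇒ (incidence p ℓ) i , ⇒ (incidence q ℓ) j)
          (λ (p≉q , ℓ , i , j) → p≉q ∘ P.to-cong , L.from ℓ , lift i , lift j)
      }

    IsConfiguration-resp : ∀ {n r} → IsConfiguration n r D → IsConfiguration n r C
    IsConfiguration-resp c = record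
      { #points   = Composition.inverse on-points #points
      ; #lines    = Composition.inverse on-lines #lines
      ; #through  = λ p → Composition.inverse
          (restrict on-lines (incidence p) (D.on-resp Dᵖ.refl)) (#through (P.to p))
      ; #on       = λ ℓ → Composition.inverse
          (restrict on-points (λ p → incidence p ℓ) (λ e → D.on-resp e Dˡ.refl)) (#on (L.to ℓ))
      ; ≤1-common = λ p≉q i j i′ j′ → injectiveˡ (≤1-common (p≉q ∘ injectiveᵖ)
          (⇒ (incidence _ _) i) (⇒ (incidence _ _) j) (⇒ (incidence _ _) i′) (⇒ (incidence _ _) j′))
      }
      where open IsConfiguration c

≅ᶜ-trans : {B C D : Incidence} → B ≅ᶜ C → C ≅ᶜ D → B ≅ᶜ D
≅ᶜ-trans φ ψ = record
  { on-points = Composition.inverse (_≅ᶜ_.on-points φ) (_≅ᶜ_.on-points ψ)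
  ; on-lines  = Composition.inverse (_≅ᶜ_.on-lines φ) (_≅ᶜ_.on-lines ψ)
  ; incidence = λ p ℓ → ⇔-trans (_≅ᶜ_.incidence φ p ℓ) (_≅ᶜ_.incidence ψ _ _)
  }

SelfDual-resp : {C D : Incidence} → C ≅ᶜ D → SelfDual D → SelfDual C
SelfDual-resp φ δ = ≅ᶜ-trans φ (≅ᶜ-trans δ (≅ᶜ-sym (dual-cong φ)))

-- Copies of complete graphs as ordered cliques.

module _ {G : Graph} {n : ℕ} where
  open Graph G using (V; _≈_; Adj)
  private module G = Setoid (Graph.vertices G)

  -- The isomorphism with `K n` that a copy carries amounts to an ordering of its vertices.
  tuple : Copy G (K n) → Fin n → V
  tuple (_ , g) i = proj₁ (_≅_.from g i)

  tuple-adjacent : (c : Copy G (K n)) → ∀ {i j} → i ≢ j → Adj (tuple c i) (tuple c j)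
  tuple-adjacent (_ , g) {i} {j} = ⇒ (_≅_.adjacency (≅-sym g) i j)

  ∈⇔∈tuple : ((S , g) : Copy G (K n)) → ∀ v → (_∈ᵛ_ G v S) ⇔ (∃[ i ] tuple (S , g) i ≈ v)
  ∈⇔∈tuple (S , g) v = mk⇔
    (λ v∈S → _≅_.to g (v , v∈S) , Inverse.strictlyInverseʳ (_≅_.bijection g) (v , v∈S))
    (λ (i , e) → subst T (Func.cong S e) (proj₂ (_≅_.from g i)))

  -- Injectivity of `t` comes from irreflexivity: entries at different indices are adjacent, hence
  -- not equal.
  cliqueCopy : (S : VertexSet G) (t : Fin n → V) → (∀ {i j} → i ≢ j → Adj (t i) (t j)) →
    (∀ v → (_∈ᵛ_ G v S) ⇔ (∃[ i ] t i ≈ v)) → Copy G (K n)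
  cliqueCopy S t adjacent ∈⇔ = S , ≅-sym (record
    { bijection = bijective⇒inverse
        (record { to = λ i → t i , ⇐ (∈⇔ (t i)) (i , G.refl) ; cong = λ { refl → G.refl } })
        injective (λ (v , v∈S) → ⇒ (∈⇔ v) v∈S)
    ; adjacency = λ i j → mk⇔ adjacent (λ { a refl → Graph.irreflexive G G.refl a })
    })
    where
    injective : ∀ {i j} → t i ≈ t j → i ≡ j
    injective {i} {j} e = decidable-stable (i ≟ j) (λ i≢j → Graph.irreflexive G e (adjacent i≢j))

  -- The order that g gives to S is carried by f to an order of S′; both are
  -- reached by automorphisms from the same ordered clique.
  extends : (base : Fin n → V) (S S′ : VertexSet G) (g : induced G S ≅ K n)
    (f : induced G S ≅ induced G S′) (α α′ : G ≅ G) →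
    (∀ i → _≅_.to α (base i) ≈ tuple (S , g) i) →
    (∀ i → _≅_.to α′ (base i) ≈ tuple (S′ , ≅-trans (≅-sym f) g) i) →
    ExtendsToAutomorphism G S S′ f
  extends base S S′ g f α α′ p p′ = ≅-trans (≅-sym α) α′ , λ s → let i = _≅_.to g s in begin
    proj₁ (f.to s)                       ≈⟨ f.to-cong {s} {_≅_.from g i} (G.sym (g.strictlyInverseʳ s)) ⟩
    proj₁ (f.to (_≅_.from g i))          ≈⟨ p′ i ⟨
    α′.to (base i)                       ≈⟨ α′.to-cong (α.strictlyInverseʳ (base i)) ⟨
    α′.to (α.from (α.to (base i)))       ≈⟨ α′.to-cong (α.from-cong (p i)) ⟩
    α′.to (α.from (proj₁ (_≅_.from g i))) ≈⟨ α′.to-cong (α.from-cong (g.strictlyInverseʳ s)) ⟩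
    α′.to (α.from (proj₁ s))             ∎
    where
    open import Relation.Binary.Reasoning.Setoid (Graph.vertices G)
    module f = Inverse (_≅_.bijection f)
    module g = Inverse (_≅_.bijection g)
    module α = Inverse (_≅_.bijection α)
    module α′ = Inverse (_≅_.bijection α′)

-- Decision procedures for the exhaustive checks.

_⇔-dec_ : ∀ {A B : Set} → Dec A → Dec B → Dec (A ⇔ B)
A? ⇔-dec B? = map′ (uncurry mk⇔) (λ e → ⇒ e , ⇐ e) ((A? →-dec B?) ×-dec (B? →-dec A?))

symClosure? : ∀ {A : Set} {R : A → A → Set} → Decidable R → Decidable (SymClosure R)
symClosure? R? u v = map′ [ fwd , bwd ] (λ { (fwd r) → inj₁ r ; (bwd r) → inj₂ r }) (R? u v ⊎-dec R? v u)

_≟ᵛ_ : DecidableEquality Vertex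
outer i ≟ᵛ outer j = map′ (cong outer) (λ { refl → refl }) (i ≟ j)
outer i ≟ᵛ inner j = no λ ()
inner i ≟ᵛ outer j = no λ ()
inner i ≟ᵛ inner j = map′ (cong inner) (λ { refl → refl }) (i ≟ j)

open import Data.Vec.Membership.DecPropositional _≟ᵛ_ using (_∈_; _∈?_)

allᵛ? : {P : Vertex → Set} → Decidable₁ P → Dec (∀ v → P v)
allᵛ? P? = map′ (λ { (f , g) (outer i) → f i ; (f , g) (inner i) → g i }) (λ h → h ∘ outer , h ∘ inner)
  (all? (P? ∘ outer) ×-dec all? (P? ∘ inner))

anyᵛ? : {P : Vertex → Set} → Decidable₁ P → Dec (∃ P)
anyᵛ? P? = map′ [ (λ (i , p) → outer i , p) , (λ (i , p) → inner i , p) ]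
  (λ { (outer i , p) → inj₁ (i , p) ; (inner i , p) → inj₂ (i , p) })
  (any? (P? ∘ outer) ⊎-dec any? (P? ∘ inner))

infix 4 _~_ _~?_ _⌢_ _⌢?_ _∈ᵉ_ _∈ᵉ?_

_~_ : Vertex → Vertex → Set
_~_ = Graph.Adj petersen

_~?_ : Decidable _~_
_~?_ = symClosure? λ
  { (outer i) (outer j) → map′ (λ { refl → pentagon i }) (λ { (pentagon _) → refl }) (j ≟ i ⊕ 1)
  ; (outer i) (inner j) → map′ (λ { refl → spoke i }) (λ { (spoke _) → refl }) (j ≟ i)
  ; (inner i) (outer j) → no λ ()
  ; (inner i) (inner j) → map′ (λ { refl → pentagram i }) (λ { (pentagram _) → refl }) (j ≟ i ⊕ 2)
  }

-- The graph `J` and the pairs in `Fin 5`.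

J : Graph
J = complement petersen

_⌢_ : Vertex → Vertex → Set
_⌢_ = Graph.Adj J

_⌢?_ : Decidable _⌢_
p ⌢? q = ¬? (p ≟ᵛ q) ×-dec ¬? (p ~? q)

-- Outer vertices are the pairs at cyclic distance 2, inner ones the consecutive pairs. The offsets
-- make every pentagon, spoke and pentagram link join disjoint pairs.
edge : Vertex → Edge (K 5)
edge (outer i) = (i , i ⊕ 2) , from-yes (all? λ (i : Fin 5) → ¬? (i ≟ i ⊕ 2)) i
edge (inner i) = (i ⊕ 3 , i ⊕ 4) , from-yes (all? λ (i : Fin 5) → ¬? (i ⊕ 3 ≟ i ⊕ 4)) i

open Setoid (edges (K 5)) using () renaming (_≈_ to _≈ᵉ_)

_≈ᵉ?_ : Decidable _≈ᵉ_
((u , v) , _) ≈ᵉ? ((u′ , v′) , _) = (u ≟ u′) ×-dec (v ≟ v′) ⊎-dec (u ≟ v′) ×-dec (v ≟ u′)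

_∈ᵉ_ : Fin 5 → Vertex → Set
c ∈ᵉ p = EndOf (K 5) c (edge p)

_∈ᵉ?_ : Decidable _∈ᵉ_
c ∈ᵉ? p = (c ≟ proj₁ (proj₁ (edge p))) ⊎-dec (c ≟ proj₂ (proj₁ (edge p)))

abstract
  edge-injective : ∀ p q → edge p ≈ᵉ edge q → p ≡ q
  edge-injective = from-yes (allᵛ? λ p → allᵛ? λ q → (edge p ≈ᵉ? edge q) →-dec (p ≟ᵛ q))

  -- Phrased through end points, since the proof of `u ≢ v` inside an edge cannot be enumerated.
  edge-surjective : ∀ u v → u ≢ v → ∃[ p ] let (u′ , v′) , _ = edge p in
    (u′ ≡ u × v′ ≡ v) ⊎ (u′ ≡ v × v′ ≡ u)
  edge-surjective = from-yes (all? λ u → all? λ v → ¬? (u ≟ v) →-dec (anyᵛ? λ p →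
    let (u′ , v′) , _ = edge p in
    (u′ ≟ u) ×-dec (v′ ≟ v) ⊎-dec (u′ ≟ v) ×-dec (v′ ≟ u)))

  ⌢⇔edges-adjacent : ∀ p q → p ⌢ q ⇔ Graph.Adj (lineGraph (K 5)) (edge p) (edge q)
  ⌢⇔edges-adjacent = from-yes (allᵛ? λ p → allᵛ? λ q → (p ⌢? q) ⇔-dec
    (¬? (edge p ≈ᵉ? edge q) ×-dec any? λ w → (w ∈ᵉ? p) ×-dec (w ∈ᵉ? q)))

J≅lineGraph : J ≅ lineGraph (K 5)
J≅lineGraph = record
  { bijection = bijective⇒inverse
      (record { to = edge ; cong = λ { {p} refl → Setoid.refl (edges (K 5)) {edge p} } })
      (λ {p} {q} → edge-injective p q)
      (λ ((u , v) , u≢v) → edge-surjective u v u≢v)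
  ; adjacency = ⌢⇔edges-adjacent
  }

-- The cliques of `J`: stars and triangles.

-- Cliques are grown from the last entry forwards, and a vertex is put in front only if it is
-- adjacent to the whole tail. Of the 10000 quadruples just the 120 ordered 4-cliques reach `P?`.
allCliques? : ∀ {n} {P : Vec Vertex n → Set} → (∀ t → Dec (P t)) → Dec (∀ t → AllPairs _⌢_ t → P t)
allCliques? {0} P? = map′ (λ { p [] [] → p }) (λ f → f [] []) (P? [])
allCliques? {suc n} P? = map′ (λ { f (p ∷ t) (a ∷ c) → f t c p a }) (λ f t c p a → f (p ∷ t) (a ∷ c))
  (allCliques? λ t → allᵛ? λ p → Allᵛ.all? (p ⌢?_) t →-dec P? (p ∷ t))

star : Fin 5 → Vec Vertex 4
star c = outer c ∷ outer (c ⊕ 3) ∷ inner (c ⊕ 1) ∷ inner (c ⊕ 2) ∷ []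

-- The three Petersen neighbours of the vertex, `⊕ 4` and `⊕ 3` being steps of -1 and -2 modulo 5.
-- As pairs they lie in the 3-set complementary to `ℓ`, so they meet each other.
line : Vertex → Vec Vertex 3
line (outer i) = inner i ∷ outer (i ⊕ 1) ∷ outer (i ⊕ 4) ∷ []
line (inner i) = outer i ∷ inner (i ⊕ 2) ∷ inner (i ⊕ 3) ∷ []

abstract
  star-clique : ∀ c → AllPairs _⌢_ (star c)
  star-clique = from-yes (all? λ c → allPairs? _⌢?_ (star c))

  line-clique : ∀ ℓ → AllPairs _⌢_ (line ℓ)
  line-clique = from-yes (allᵛ? λ ℓ → allPairs? _⌢?_ (line ℓ))

  ∈star⇔ : ∀ c p → c ∈ᵉ p ⇔ p ∈ star c
  ∈star⇔ = from-yes (all? λ c → allᵛ? λ p → (c ∈ᵉ? p) ⇔-dec (p ∈? star c))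

  ∈line⇔ : ∀ ℓ p → p ~ ℓ ⇔ p ∈ line ℓ
  ∈line⇔ = from-yes (allᵛ? λ ℓ → allᵛ? λ p → (p ~? ℓ) ⇔-dec (p ∈? line ℓ))

  -- Pairwise meeting pairs either share an element or form a triangle, and a triangle has only
  -- three of them.
  4-cliques : (t : Vec Vertex 4) → AllPairs _⌢_ t → ∃[ c ] (∀ p → c ∈ᵉ p ⇔ p ∈ t)
  4-cliques = from-yes (allCliques? λ (t : Vec Vertex 4) → any? λ c → allᵛ? λ p → (c ∈ᵉ? p) ⇔-dec (p ∈? t))

  -- In the second case the pairs are the sides of a triangle of K₅, and `ℓ` is the pair of the two
  -- remaining points.
  3-cliques : (t : Vec Vertex 3) → AllPairs _⌢_ t →
    (∃[ c ] Allᵛ (c ∈ᵉ_) t) ⊎ (∃[ ℓ ] (∀ p → p ~ ℓ ⇔ p ∈ t))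
  3-cliques = from-yes (allCliques? λ (t : Vec Vertex 3) → (any? λ c → Allᵛ.all? (c ∈ᵉ?_) t) ⊎-dec
    (anyᵛ? λ ℓ → allᵛ? λ p → (p ~? ℓ) ⇔-dec (p ∈? t)))

  line⊈star : ∀ ℓ c → ¬ (∀ p → p ~ ℓ → c ∈ᵉ p)
  line⊈star = from-yes (allᵛ? λ ℓ → all? λ c → ¬? (allᵛ? λ p → (p ~? ℓ) →-dec (c ∈ᵉ? p)))

  -- Inclusion is enough, as two different stars share a single pair.
  star-injective : ∀ c c′ → (∀ p → c ∈ᵉ p → c′ ∈ᵉ p) → c ≡ c′
  star-injective = from-yes (all? λ c → all? λ c′ →
    (allᵛ? λ p → (c ∈ᵉ? p) →-dec (c′ ∈ᵉ? p)) →-dec (c ≟ c′))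

  line-injective : ∀ ℓ ℓ′ → (∀ p → p ~ ℓ → p ~ ℓ′) → ℓ ≡ ℓ′
  line-injective = from-yes (allᵛ? λ ℓ → allᵛ? λ ℓ′ →
    (allᵛ? λ p → (p ~? ℓ) →-dec (p ~? ℓ′)) →-dec (ℓ ≟ᵛ ℓ′))

  -- Two meeting pairs are `{c,x}` and `{c,y}`: `c` is their only common element, and `c`, `x`, `y`
  -- span the only triangle with both as sides. Its third side `{x,y}` avoids `c`.
  star∩line : ∀ p q → p ⌢ q → ∃[ c ] ∃[ ℓ ]
    (∀ r → (c ∈ᵉ r × r ~ ℓ) ⇔ r ∈ p ∷ q ∷ []) ×
    (∀ c′ → c′ ∈ᵉ p → c′ ∈ᵉ q → c ≡ c′) × (∀ ℓ′ → p ~ ℓ′ → q ~ ℓ′ → ℓ ≡ ℓ′)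
  star∩line = from-yes (allᵛ? λ p → allᵛ? λ q → (p ⌢? q) →-dec (any? λ c → anyᵛ? λ ℓ →
    (allᵛ? λ r → ((c ∈ᵉ? r) ×-dec (r ~? ℓ)) ⇔-dec (r ∈? p ∷ q ∷ [])) ×-dec
    (all? λ c′ → (c′ ∈ᵉ? p) →-dec (c′ ∈ᵉ? q) →-dec (c ≟ c′)) ×-dec
    (allᵛ? λ ℓ′ → (p ~? ℓ′) →-dec (q ~? ℓ′) →-dec (ℓ ≟ᵛ ℓ′))))

-- The action of the permutations of `Fin 5` on ordered cliques.

-- A factorial code: each `insert 0F i` sends 0 to `i` and leaves the rest to the next digit. All
-- 120 permutations arise, so a search for one is finite.
permutation : Fin 5 × Fin 4 × Fin 3 × Fin 2 → Permutation′ 5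
permutation (i , j , k , l) = insert 0F i (insert 0F j (insert 0F k (insert 0F l (Permutation.id))))

anyPermutation? : {P : Permutation′ 5 → Set} → Decidable₁ P → Dec (∃[ x ] P (permutation x))
anyPermutation? P? = map′
  (λ (i , j , k , l , p) → (i , j , k , l) , p) (λ ((i , j , k , l) , p) → i , j , k , l , p)
  (any? λ i → any? λ j → any? λ k → any? λ l → P? (permutation (i , j , k , l)))

Moves : Permutation′ 5 → Vertex → Vertex → Set
Moves π p q = _≅_.to (lineGraph-cong (K-cong π)) (edge p) ≈ᵉ edge q

moves? : ∀ π → Decidable (Moves π)
moves? π p q = _≅_.to (lineGraph-cong (K-cong π)) (edge p) ≈ᵉ? edge q

_↝_ : ∀ {n} → Vec Vertex n → Vec Vertex n → Set
t ↝ t′ = ∃[ x ] Pointwise (Moves (permutation x)) t t′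

_↝?_ : ∀ {n} → Decidable (_↝_ {n})
t ↝? t′ = anyPermutation? λ π → Pointwise.decidable (moves? π) t t′

base₂ : Vec Vertex 2
base₂ = outer 0F ∷ outer 3F ∷ []

abstract
  -- An ordered pair `{c,x}`, `{c,y}` is the same as the triple `c`, `x`, `y` of distinct points,
  -- and any such triple can be permuted to any other.
  2-cliques-moved : ∀ t → AllPairs _⌢_ t → base₂ ↝ t
  2-cliques-moved = from-yes (allCliques? (base₂ ↝?_))

  -- Ordering the sides of a triangle orders its corners by opposition, so permutations move one
  -- ordered triangle to all others.
  3-cliques-moved : ∀ t → AllPairs _⌢_ t → (∃[ c ] Allᵛ (c ∈ᵉ_) t) ⊎ (line (outer 0F) ↝ t)
  3-cliques-moved = from-yes (allCliques? λ t → (any? λ c → Allᵛ.all? (c ∈ᵉ?_) t) ⊎-dec (line (outer 0F) ↝? t))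

  -- An ordered star is its centre followed by an order of the other four points, which determines a
  -- permutation.
  4-cliques-moved : ∀ t → AllPairs _⌢_ t → star 0F ↝ t
  4-cliques-moved = from-yes (allCliques? (star 0F ↝?_))

-- The configuration of points and lines on the Petersen graph.

-- Points and lines are both the pairs of Fin 5: the point p is on the line ℓ
-- when the pairs are disjoint, so that ℓ is the triangle on the complement of
-- its pair.
Δ : Incidence
Δ = record
  { points  = setoid Vertex
  ; lines   = setoid Vertex
  ; _on_    = _~_
  ; on-resp = λ { refl refl i → i }
  }

vertex-count : HasSize (setoid Vertex) 10
vertex-count = Composition.inverse
  (mk↔ₛ′ (λ { (outer i) → inj₁ i ; (inner i) → inj₂ i }) [ outer , inner ]
    (λ { (inj₁ _) → refl ; (inj₂ _) → refl }) (λ { (outer _) → refl ; (inner _) → refl }))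
  (Symmetry.inverse (+↔⊎ {5} {5}))

abstract
  line-lookup-injective : ∀ ℓ i j → lookup (line ℓ) i ≡ lookup (line ℓ) j → i ≡ j
  line-lookup-injective = from-yes (allᵛ? λ ℓ → all? λ i → all? λ j →
    (lookup (line ℓ) i ≟ᵛ lookup (line ℓ) j) →-dec (i ≟ j))

  line-lookup-~ : ∀ ℓ i → lookup (line ℓ) i ~ ℓ
  line-lookup-~ = from-yes (allᵛ? λ ℓ → all? λ i → lookup (line ℓ) i ~? ℓ)

  line-lookup-surjective : ∀ ℓ p → p ~ ℓ → ∃[ i ] lookup (line ℓ) i ≡ p
  line-lookup-surjective = from-yes (allᵛ? λ ℓ → allᵛ? λ p → (p ~? ℓ) →-dec
    (any? λ i → lookup (line ℓ) i ≟ᵛ p))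

  -- Otherwise `p`, `ℓ`, `q`, `m` would be a 4-cycle of the Petersen graph, whose girth is 5.
  ~-≤1-common : ∀ p q ℓ m → p ≢ q → p ~ ℓ → q ~ ℓ → p ~ m → q ~ m → ℓ ≡ m
  ~-≤1-common = from-yes (allᵛ? λ p → allᵛ? λ q → allᵛ? λ ℓ → allᵛ? λ m → ¬? (p ≟ᵛ q) →-dec
    (p ~? ℓ) →-dec (q ~? ℓ) →-dec (p ~? m) →-dec (q ~? m) →-dec (ℓ ≟ᵛ m))

  -- In the Petersen graph distinct non-adjacent vertices have exactly one common neighbour, and
  -- adjacent ones have none.
  ⌢⇔collinear : ∀ p q → p ⌢ q ⇔ (p ≢ q × ∃[ ℓ ] (p ~ ℓ × q ~ ℓ))
  ⌢⇔collinear = from-yes (allᵛ? λ p → allᵛ? λ q → (p ⌢? q) ⇔-dec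
    (¬? (p ≟ᵛ q) ×-dec anyᵛ? λ ℓ → (p ~? ℓ) ×-dec (q ~? ℓ)))

neighbour-count : ∀ ℓ → HasSize (On.setoid {B = ∃ (_~ ℓ)} (setoid Vertex) proj₁) 3
neighbour-count ℓ = enumeration _ (λ i → lookup (line ℓ) i , line-lookup-~ ℓ i)
  (line-lookup-injective ℓ _ _) (λ (p , p~ℓ) → line-lookup-surjective ℓ p p~ℓ)

Δ-configuration : IsConfiguration 10 3 Δ
Δ-configuration = record
  { #points   = vertex-count
  ; #lines    = vertex-count
  ; #through  = λ p → Composition.inverse
      (restrict (Identity.inverse _) (λ ℓ → mk⇔ (symmetric _) (symmetric _)) (λ { refl i → i }))
      (neighbour-count p)
  ; #on       = neighbour-count
  ; ≤1-common = ~-≤1-common _ _ _ _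
  }

Δ-self-dual : SelfDual Δ
Δ-self-dual = record
  { on-points = Identity.inverse _
  ; on-lines  = Identity.inverse _
  ; incidence = λ p ℓ → mk⇔ (symmetric _) (symmetric _)
  }

menger-Δ : menger Δ ≅ J
menger-Δ = record
  { bijection = Identity.inverse _
  ; adjacency = λ p q → ⇔-sym (⌢⇔collinear p q)
  }

-- The identification with the configuration of Desargues' theorem.

module _ where
  open Desargues

  -- The centre is the pair {3,4}, a j = {j,3}, b j = {j,4} and
  -- c j = {0,1,2} ∖ {j}.
  point : Vertex → Point
  point (outer 0F) = c 1F
  point (outer 1F) = a 1F
  point (outer 2F) = b 2F
  point (outer 3F) = a 0F
  point (outer 4F) = b 1F
  point (inner 0F) = centre
  point (inner 1F) = b 0F
  point (inner 2F) = c 2F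
  point (inner 3F) = c 0F
  point (inner 4F) = a 2F

  pair : Point → Vertex
  pair centre = inner 0F
  pair (a 0F) = outer 3F
  pair (a 1F) = outer 1F
  pair (a 2F) = inner 4F
  pair (b 0F) = inner 1F
  pair (b 1F) = outer 4F
  pair (b 2F) = outer 2F
  pair (c 0F) = inner 3F
  pair (c 1F) = outer 0F
  pair (c 2F) = inner 2F

  point∘pair : ∀ x → point (pair x) ≡ x
  point∘pair centre = refl
  point∘pair (a 0F) = refl
  point∘pair (a 1F) = refl
  point∘pair (a 2F) = refl
  point∘pair (b 0F) = refl
  point∘pair (b 1F) = refl
  point∘pair (b 2F) = refl
  point∘pair (c 0F) = refl
  point∘pair (c 1F) = refl
  point∘pair (c 2F) = refl

  -- The polarity of the configuration: a line carries the three points whose pairs are disjoint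
  -- from the pair of its pole.
  pole : Line → Point
  pole (ray j)   = c j
  pole (sideA j) = b j
  pole (sideB j) = a j
  pole axis      = centre

  polar : Point → Line
  polar centre = axis
  polar (a j)  = sideB j
  polar (b j)  = sideA j
  polar (c j)  = ray j

  polar∘pole : ∀ ℓ → polar (pole ℓ) ≡ ℓ
  polar∘pole (ray j)   = refl
  polar∘pole (sideA j) = refl
  polar∘pole (sideB j) = refl
  polar∘pole axis      = refl

  pole∘polar : ∀ x → pole (polar x) ≡ x
  pole∘polar centre = refl
  pole∘polar (a j)  = refl
  pole∘polar (b j)  = refl
  pole∘polar (c j)  = refl

  _on?_ : ∀ x ℓ → Dec (x on ℓ)
  centre on? ray j   = yes (centre-ray j)
  centre on? sideA j = no λ ()
  centre on? sideB j = no λ ()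
  centre on? axis    = no λ ()
  a i on? ray j      = map′ (λ { refl → a-ray j }) (λ { (a-ray _) → refl }) (i ≟ j)
  a i on? sideA j    = map′ a-sideA (λ { (a-sideA i≢j) → i≢j }) (¬? (i ≟ j))
  a i on? sideB j    = no λ ()
  a i on? axis       = no λ ()
  b i on? ray j      = map′ (λ { refl → b-ray j }) (λ { (b-ray _) → refl }) (i ≟ j)
  b i on? sideA j    = no λ ()
  b i on? sideB j    = map′ b-sideB (λ { (b-sideB i≢j) → i≢j }) (¬? (i ≟ j))
  b i on? axis       = no λ ()
  c i on? ray j      = no λ ()
  c i on? sideA j    = map′ (λ { refl → c-sideA j }) (λ { (c-sideA _) → refl }) (i ≟ j)
  c i on? sideB j    = map′ (λ { refl → c-sideB j }) (λ { (c-sideB _) → refl }) (i ≟ j)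
  c i on? axis       = yes (c-axis i)

  abstract
    pair∘point : ∀ p → pair (point p) ≡ p
    pair∘point = from-yes (allᵛ? λ p → pair (point p) ≟ᵛ p)

    ~⇔on : ∀ p ℓ → p ~ ℓ ⇔ (point p on polar (point ℓ))
    ~⇔on = from-yes (allᵛ? λ p → allᵛ? λ ℓ → (p ~? ℓ) ⇔-dec (point p on? polar (point ℓ)))

  Δ≅desargues : Δ ≅ᶜ desarguesConfiguration
  Δ≅desargues = record
    { on-points = vertex↔point
    ; on-lines  = Composition.inverse vertex↔point (mk↔ₛ′ polar pole polar∘pole pole∘polar)
    ; incidence = ~⇔on
    }
    where vertex↔point = mk↔ₛ′ point pair point∘pair pair∘point

-- The components of `Y`, and `𝒟` as a Levi graph.

part : Fin 2 → VertexSet Y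
part 0F = part₁
part 1F = part₂

-- Chosen so that p ~ q exactly when vertex 0F p and vertex 1F q are adjacent
-- in 𝒟: the triangle of a line ℓ in Y₁ is the neighbourhood of vertex 1F ℓ.
vertex : Fin 2 → Vertex → Fin 20
vertex 0F (outer y) = y ₂
vertex 0F (inner y) = (y ⊕ 4) ₀
vertex 1F (outer y) = (y ⊕ 4) ₁
vertex 1F (inner y) = y ₃

allᶠ? : {P : Family → Set} → (∀ F → Dec (P F)) → Dec (∀ F → P F)
allᶠ? P? = map′ (λ { (a , b , c , d) → λ { A → a ; B → b ; C → c ; D → d } })
  (λ f → f A , f B , f C , f D) (P? A ×-dec P? B ×-dec P? C ×-dec P? D)

anyᶠ? : {P : Family → Set} → (∀ F → Dec (P F)) → Dec (∃ P)
anyᶠ? P? = map′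
  (λ { (inj₁ a) → A , a ; (inj₂ (inj₁ b)) → B , b
     ; (inj₂ (inj₂ (inj₁ c))) → C , c ; (inj₂ (inj₂ (inj₂ d))) → D , d })
  (λ { (A , a) → inj₁ a ; (B , b) → inj₂ (inj₁ b)
     ; (C , c) → inj₂ (inj₂ (inj₁ c)) ; (D , d) → inj₂ (inj₂ (inj₂ d)) })
  (P? A ⊎-dec P? B ⊎-dec P? C ⊎-dec P? D)

squareArc? : ∀ c u w v → Dec (SquareArc c u w v)
squareArc? c u w v = any? λ i → (lookup c i ≟ u) ×-dec (lookup c (i ⊕ 1) ≟ w) ×-dec (lookup c (i ⊕ 2) ≟ v)

link? : Decidable Link
link? u v = map′
  (λ { (inj₁ refl) → cycle u
     ; (inj₂ (inj₁ (x , refl , refl))) → chord₃₀ x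
     ; (inj₂ (inj₂ (x , refl , refl))) → chord₁₂ x })
  (λ { (cycle _) → inj₁ refl
     ; (chord₃₀ x) → inj₂ (inj₁ (x , refl , refl))
     ; (chord₁₂ x) → inj₂ (inj₂ (x , refl , refl)) })
  ((v ≟ u ⊕ 1) ⊎-dec (any? λ x → (u ≟ x ₃) ×-dec (v ≟ (x ⊕ 2) ₀))
               ⊎-dec (any? λ x → (u ≟ x ₁) ×-dec (v ≟ (x ⊕ 2) ₂)))

abstract
  vertex-injective : ∀ s p s′ q → vertex s p ≡ vertex s′ q → s ≡ s′ × p ≡ q
  vertex-injective = from-yes (all? λ s → allᵛ? λ p → all? λ s′ → allᵛ? λ q →
    (vertex s p ≟ vertex s′ q) →-dec (s ≟ s′) ×-dec (p ≟ᵛ q))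

  vertex-surjective : ∀ v → ∃[ s ] ∃[ p ] vertex s p ≡ v
  vertex-surjective = from-yes (all? λ v → any? λ s → anyᵛ? λ p → vertex s p ≟ v)

  ∈part⇔ : ∀ s v → (_∈ᵛ_ Y v (part s)) ⇔ (∃[ p ] vertex s p ≡ v)
  ∈part⇔ = from-yes (all? λ s → all? λ v → T? (Func.to (part s) v) ⇔-dec (anyᵛ? λ p → vertex s p ≟ v))

  parts-partition : ∀ v → (_∈ᵛ_ Y v part₁ × ¬ _∈ᵛ_ Y v part₂) ⊎ (_∈ᵛ_ Y v part₂ × ¬ _∈ᵛ_ Y v part₁)
  parts-partition = from-yes (all? λ v → (T? (Func.to part₁ v) ×-dec ¬? (T? (Func.to part₂ v)))
    ⊎-dec (T? (Func.to part₂ v) ×-dec ¬? (T? (Func.to part₁ v))))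

  ~⇔linked : ∀ p q → p ~ q ⇔ SymClosure Link (vertex 0F p) (vertex 1F q)
  ~⇔linked = from-yes (allᵛ? λ p → allᵛ? λ q → (p ~? q) ⇔-dec symClosure? link? (vertex 0F p) (vertex 1F q))

  𝒟-bipartite : ∀ s p q → ¬ SymClosure Link (vertex s p) (vertex s q)
  𝒟-bipartite = from-yes (all? λ s → allᵛ? λ p → allᵛ? λ q → ¬? (symClosure? link? (vertex s p) (vertex s q)))

  -- The orientations are coherent: each 2-path of a hexagon is also traversed backwards. Hence a
  -- single arc already gives an edge of `Y`.
  arc-opposite : ∀ F x i → let c = hexagon F x in
    ∃[ G ] ∃[ y ] SquareArc (hexagon G y) (lookup c (i ⊕ 2)) (lookup c (i ⊕ 1)) (lookup c i)
  arc-opposite = from-yes (allᶠ? λ F → all? λ x → all? λ i → let c = hexagon F x in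
    anyᶠ? λ G → any? λ y → squareArc? (hexagon G y) (lookup c (i ⊕ 2)) (lookup c (i ⊕ 1)) (lookup c i))

  -- The ends of a 2-path in the bipartite graph `𝒟` are in the same part, and the middle vertex is
  -- a common Petersen neighbour of their labels.
  arc⇒⌢ : ∀ F x i → ∃[ s ] ∃[ p ] (vertex s p ≡ lookup (hexagon F x) i ×
    ∃[ q ] (vertex s q ≡ lookup (hexagon F x) (i ⊕ 2) × p ⌢ q))
  arc⇒⌢ = from-yes (allᶠ? λ F → all? λ x → all? λ i → any? λ s → anyᵛ? λ p →
    (vertex s p ≟ lookup (hexagon F x) i) ×-dec
    anyᵛ? λ q → (vertex s q ≟ lookup (hexagon F x) (i ⊕ 2)) ×-dec (p ⌢? q))

  -- The labels have one common Petersen neighbour, and the 2-path through it lies on a hexagon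
  -- running from `p` to `q`.
  ⌢⇒arc : ∀ s p q → p ⌢ q → ∃[ F ] ∃[ x ] ∃[ i ]
    (lookup (hexagon F x) i ≡ vertex s p × lookup (hexagon F x) (i ⊕ 2) ≡ vertex s q)
  ⌢⇒arc = from-yes (all? λ s → allᵛ? λ p → allᵛ? λ q → (p ⌢? q) →-dec
    anyᶠ? λ F → any? λ x → any? λ i →
    (lookup (hexagon F x) i ≟ vertex s p) ×-dec (lookup (hexagon F x) (i ⊕ 2) ≟ vertex s q))

  -- Disjoint pairs `{a,b}` and `{c,d}` both meet `{a,c}`. This bounds the paths needed for
  -- connectedness.
  J-diameter : ∀ p q → p ≡ q ⊎ p ⌢ q ⊎ ∃[ r ] (p ⌢ r × r ⌢ q)
  J-diameter = from-yes (allᵛ? λ p → allᵛ? λ q →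
    (p ≟ᵛ q) ⊎-dec (p ⌢? q) ⊎-dec (anyᵛ? λ r → (p ⌢? r) ×-dec (r ⌢? q)))

opposite⇒⌢ : ∀ s {p v} → OppositeArcs (vertex s p) v → ∃[ q ] (vertex s q ≡ v × p ⌢ q)
opposite⇒⌢ s {p} (_ , (F , x , i , e , _ , e′) , _) with s′ , p′ , d , q , d′ , p′⌢q ← arc⇒⌢ F x i
  with refl , refl ← vertex-injective s′ p′ s p (trans d e) = q , trans d′ e′ , p′⌢q

⌢⇒opposite : ∀ s p q → p ⌢ q → OppositeArcs (vertex s p) (vertex s q)
⌢⇒opposite s p q p⌢q with F , x , i , e , e′ ← ⌢⇒arc s p q p⌢q =
  lookup (hexagon F x) (i ⊕ 1) , subst₂ (λ u v → Arc u v × Arc⁻ u v) e e′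
    ((F , x , i , refl , refl , refl) , arc-opposite F x i)
  where
  Arc Arc⁻ : Fin 20 → Fin 20 → Set
  Arc  u v = ∃[ G ] ∃[ y ] SquareArc (hexagon G y) u (lookup (hexagon F x) (i ⊕ 1)) v
  Arc⁻ u v = Arc v u

component≅J : ∀ s → induced Y (part s) ≅ J
component≅J s = ≅-sym (record
  { bijection = bijective⇒inverse
      (record { to = λ p → vertex s p , ⇐ (∈part⇔ s _) (p , refl) ; cong = cong (vertex s) })
      (proj₂ ∘ vertex-injective s _ s _)
      (λ (v , v∈) → ⇒ (∈part⇔ s v) v∈)
  ; adjacency = λ p q → mk⇔ (⌢⇒opposite s p q) (λ a → let q′ , e , p⌢q′ = opposite⇒⌢ s a in
      subst (p ⌢_) (proj₂ (vertex-injective s q′ s q e)) p⌢q′)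
  })

component : ∀ s → IsComponent Y (part s)
component s = (vertex s (outer 0F) , ⇐ (∈part⇔ s _) (outer 0F , refl)) , λ u v u∈ →
  mk⇔ (connected (⇒ (∈part⇔ s u) u∈) ∘ ⇒ (∈part⇔ s v)) (λ { (_ , path , refl) → closed u∈ path })
  where
  connected : ∀ {u v} → ∃[ p ] vertex s p ≡ u → ∃[ q ] vertex s q ≡ v → Reachable Y u v
  connected (p , refl) (q , refl) = vertex s q , path (J-diameter p q) , refl
    where
    path : p ≡ q ⊎ p ⌢ q ⊎ ∃[ r ] (p ⌢ r × r ⌢ q) → Star OppositeArcs (vertex s p) (vertex s q)
    path (inj₁ refl)                   = ε
    path (inj₂ (inj₁ p⌢q))             = ⌢⇒opposite s p q p⌢q ◅ ε
    path (inj₂ (inj₂ (r , p⌢r , r⌢q))) = ⌢⇒opposite s p r p⌢r ◅ ⌢⇒opposite s r q r⌢q ◅ ε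

  closed : ∀ {u v} → _∈ᵛ_ Y u (part s) → Star OppositeArcs u v → _∈ᵛ_ Y v (part s)
  closed u∈ ε = u∈
  closed {u} u∈ (a ◅ path) with p , refl ← ⇒ (∈part⇔ s u) u∈ =
    let q , e , _ = opposite⇒⌢ s a in closed (⇐ (∈part⇔ s _) (q , e)) path

levi-Δ : levi Δ ≅ 𝒟
levi-Δ = record
  { bijection = bijective⇒inverse
      (record { to = to ; cong = λ { (inj₁ refl) → refl ; (inj₂ refl) → refl } })
      (λ {x} {y} → injective x y)
      surjective
  ; adjacency = λ
      { (inj₁ p) (inj₂ ℓ) → ~⇔linked p ℓ
      ; (inj₂ ℓ) (inj₁ p) → ⇔-trans (~⇔linked p ℓ) (mk⇔ (symmetric Link) (symmetric Link))
      ; (inj₁ p) (inj₁ q) → mk⇔ (λ ()) (𝒟-bipartite 0F p q)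
      ; (inj₂ ℓ) (inj₂ m) → mk⇔ (λ ()) (𝒟-bipartite 1F ℓ m)
      }
  }
  where
  open Setoid (Graph.vertices (levi Δ)) using (_≈_)

  to : Vertex ⊎ Vertex → Fin 20
  to = [ vertex 0F , vertex 1F ]

  injective : ∀ x y → to x ≡ to y → x ≈ y
  injective (inj₁ p) (inj₁ q) e = inj₁ (proj₂ (vertex-injective 0F p 0F q e))
  injective (inj₂ p) (inj₂ q) e = inj₂ (proj₂ (vertex-injective 1F p 1F q e))
  injective (inj₁ p) (inj₂ q) e with () ← proj₁ (vertex-injective 0F p 1F q e)
  injective (inj₂ p) (inj₁ q) e with () ← proj₁ (vertex-injective 1F p 0F q e)

  surjective : ∀ v → ∃[ x ] to x ≡ v
  surjective v with vertex-surjective v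
  ... | 0F , p , e = inj₁ p , e
  ... | 1F , p , e = inj₂ p , e

complement-lineGraph : complement (lineGraph (K 5)) ≅ petersen
complement-lineGraph = ≅-trans (complement-cong (≅-sym J≅lineGraph)) (complement-involutive petersen _~?_)

-- Boolean membership and copies of complete graphs in one another.

-- Copies are compared by Boolean characteristic functions, so equivalent membership has to become
-- an equation.
T-⇔→≡ : ∀ {x y} → T x ⇔ T y → x ≡ y
T-⇔→≡ e = ⇔→≡ (⇔-trans (⇔-sym T-≡) (⇔-trans e T-≡))

≡→T-⇔ : ∀ {x y} → x ≡ y → T x ⇔ T y
≡→T-⇔ refl = mk⇔ id id

True⇔ : ∀ {P : Set} (P? : Dec P) → T (isYes P?) ⇔ P
True⇔ P? = mk⇔ (toWitness {a? = P?}) (fromWitness {a? = P?})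

lookup-AllPairs : ∀ {n} {t : Vec Vertex n} → AllPairs _⌢_ t → ∀ {i j} → i ≢ j → lookup t i ⌢ lookup t j
lookup-AllPairs (_ ∷ _)  {0F}    {0F}    i≢j = contradiction refl i≢j
lookup-AllPairs (a ∷ _)  {0F}    {suc j} i≢j = Allₚ.lookup⁺ a j
lookup-AllPairs (a ∷ _)  {suc i} {0F}    i≢j = Graph.symmetricᴬ J (Allₚ.lookup⁺ a i)
lookup-AllPairs (_ ∷ as) {suc i} {suc j} i≢j = lookup-AllPairs as (i≢j ∘ cong suc)

K⊆K-suc : ∀ n → Subgraph (K n) (K (suc n))
K⊆K-suc n = record { to = inject₁ ; cong = cong inject₁ }
  , (λ _ _ → inject₁-injective) , λ _ _ → _∘ inject₁-injective

initialCopy : ∀ m n → Copy (K (m + n)) (K m)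
initialCopy m n = cliqueCopy
  (record { to = λ v → isYes (any? λ i → i ↑ˡ n ≟ v) ; cong = cong _ })
  (_↑ˡ n) (λ i≢j → i≢j ∘ ↑ˡ-injective n _ _)
  (λ v → True⇔ (any? λ i → i ↑ˡ n ≟ v))

-- Transport of the facts about `J` to any graph isomorphic to it.

module Labelled (G : Graph) (φ : G ≅ J) where
  open Graph G using (V; _≈_; Adj)
  private module G = Setoid (Graph.vertices G)
  open Inverse (_≅_.bijection φ) using ()
    renaming (to to label; from to at; to-cong to label-cong
             ; strictlyInverseˡ to label∘at; inverseʳ to at-label)

  open Setoid (copies G (K 4)) using () renaming (_≈_ to _≈⁴_)
  open Setoid (copiesOutside G (K 3) (K 4)) using () renaming (_≈_ to _≈³_)

  infix 4 _∈ᴳ_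
  _∈ᴳ_ : V → VertexSet G → Set
  _∈ᴳ_ = _∈ᵛ_ G

  adjacent⇔⌢ : ∀ u v → Adj u v ⇔ label u ⌢ label v
  adjacent⇔⌢ = _≅_.adjacency φ

  subset : {P : Vertex → Set} → (∀ p → Dec (P p)) → VertexSet G
  subset P? = record { to = λ v → isYes (P? (label v)) ; cong = λ e → cong (λ p → isYes (P? p)) (label-cong e) }

  ≈-subset : ∀ {P : Vertex → Set} (P? : ∀ p → Dec (P p)) (S : VertexSet G) →
    (∀ v → v ∈ᴳ S ⇔ P (label v)) → Setoid._≈_ (vertexSets G) (subset P?) S
  ≈-subset P? S S⇔P v = T-⇔→≡ (⇔-trans (True⇔ (P? (label v))) (⇔-sym (S⇔P v)))

  labels : ∀ {n} → Copy G (K n) → Vec Vertex n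
  labels c = tabulate (label ∘ tuple c)

  labels-clique : ∀ {n} (c : Copy G (K n)) → AllPairs _⌢_ (labels c)
  labels-clique c = AllPairsₚ.tabulate⁺ (⇒ (adjacent⇔⌢ _ _) ∘ tuple-adjacent c)

  ∈⇔∈labels : ∀ {n} (c : Copy G (K n)) v → v ∈ᴳ proj₁ c ⇔ label v ∈ labels c
  ∈⇔∈labels c v = ⇔-trans (∈⇔∈tuple c v) (mk⇔
    (λ (i , e) → tabulate⁺ i (label-cong (G.sym e)))
    (λ e → let i , e′ = tabulate⁻ e in i , injectiveᴳ φ (sym e′)))

  -- `P` cuts out the vertex set while `t` only orders it, so membership in stars and lines unfolds
  -- to incidence of pairs.
  vecCopy : ∀ {n} {P : Vertex → Set} (P? : ∀ p → Dec (P p)) (t : Vec Vertex n) →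
    AllPairs _⌢_ t → (∀ p → P p ⇔ p ∈ t) → Copy G (K n)
  vecCopy P? t clique P⇔∈ = cliqueCopy (subset P?) (at ∘ lookup t)
    (λ i≢j → ⇒ (_≅_.adjacency (≅-sym φ) _ _) (lookup-AllPairs clique i≢j))
    (λ v → ⇔-trans (True⇔ (P? (label v))) (⇔-trans (P⇔∈ (label v)) (mk⇔
      (λ m → index m , at-label (sym (lookup-index m)))
      (λ (i , e) → ∈-lookup⁻ i (trans (sym (label∘at _)) (label-cong e))))))
    where
    ∈-lookup⁻ : ∀ {p} i → lookup t i ≡ p → p ∈ t
    ∈-lookup⁻ i refl = ∈-lookup i t

  starCopy : Fin 5 → Copy G (K 4)
  starCopy c = vecCopy (c ∈ᵉ?_) (star c) (star-clique c) (∈star⇔ c)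

  ∈starCopy⇔ : ∀ c v → v ∈ᴳ proj₁ (starCopy c) ⇔ c ∈ᵉ label v
  ∈starCopy⇔ c v = True⇔ (c ∈ᵉ? label v)

  star-surjective : (h : Copy G (K 4)) → ∃[ c ] starCopy c ≈⁴ h
  star-surjective h with c , e ← 4-cliques (labels h) (labels-clique h) =
    c , ≈-subset (c ∈ᵉ?_) (proj₁ h) (λ v → ⇔-trans (∈⇔∈labels h v) (⇔-sym (e (label v))))

  lineCopy : Vertex → Copy G (K 3)
  lineCopy ℓ = vecCopy (_~? ℓ) (line ℓ) (line-clique ℓ) (∈line⇔ ℓ)

  ∈lineCopy⇔ : ∀ ℓ v → v ∈ᴳ proj₁ (lineCopy ℓ) ⇔ label v ~ ℓ
  ∈lineCopy⇔ ℓ v = True⇔ (label v ~? ℓ)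

  ∀-label : {P Q : Vertex → Set} → (∀ v → P (label v) → Q (label v)) → ∀ p → P p → Q p
  ∀-label {P} {Q} f p = subst (λ q → P q → Q q) (label∘at p) (f (at p))

  -- Every K₄ is a star, and no point is common to all three sides of a triangle.
  lineOutside : Vertex → CopyOutside G (K 3) (K 4)
  lineOutside ℓ = lineCopy ℓ , λ (h , ℓ⊆h) → let c , e = star-surjective h in
    line⊈star ℓ c (∀-label λ v v~ℓ →
      ⇒ (∈starCopy⇔ c v) (⇐ (≡→T-⇔ (e v)) (ℓ⊆h v (⇐ (∈lineCopy⇔ ℓ v) v~ℓ))))

  not-in-star : (k : CopyOutside G (K 3) (K 4)) → ¬ (∃[ c ] Allᵛ (c ∈ᵉ_) (labels (proj₁ k)))
  not-in-star (k , outside) (c , all) = outside (starCopy c , λ v v∈k →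
    ⇐ (∈starCopy⇔ c v) (Allᵛ.lookup all (⇒ (∈⇔∈labels k v) v∈k)))

  line-surjective : (k : CopyOutside G (K 3) (K 4)) → ∃[ ℓ ] lineOutside ℓ ≈³ k
  line-surjective k with 3-cliques (labels (proj₁ k)) (labels-clique (proj₁ k))
  ... | inj₁ in-star = contradiction in-star (not-in-star k)
  ... | inj₂ (ℓ , e) = ℓ , ≈-subset (_~? ℓ) (proj₁ (proj₁ k)) (λ v →
    ⇔-trans (∈⇔∈labels (proj₁ k) v) (⇔-sym (e (label v))))

  stars : HasSize (copies G (K 4)) 5
  stars = enumeration (copies G (K 4)) starCopy
    (λ {c} {c′} e → star-injective c c′ (∀-label λ v →
      ⇒ (∈starCopy⇔ c′ v) ∘ ⇒ (≡→T-⇔ (e v)) ∘ ⇐ (∈starCopy⇔ c v)))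
    star-surjective

  lines : Inverse (copiesOutside G (K 3) (K 4)) (setoid Vertex)
  lines = enumeration (copiesOutside G (K 3) (K 4)) lineOutside
    (λ {ℓ} {m} e → line-injective ℓ m (∀-label λ v →
      ⇒ (∈lineCopy⇔ m v) ∘ ⇒ (≡→T-⇔ (e v)) ∘ ⇐ (∈lineCopy⇔ ℓ v)))
    line-surjective

  G≅lineGraph : G ≅ lineGraph (K 5)
  G≅lineGraph = ≅-trans φ J≅lineGraph

  automorphism : ∀ x → G ≅ G
  automorphism x = ≅-trans G≅lineGraph (≅-trans (lineGraph-cong (K-cong (permutation x))) (≅-sym G≅lineGraph))

  reach : ∀ {n} (b : Vec Vertex n) (c : Copy G (K n)) → b ↝ labels c →
    Σ[ α ∈ G ≅ G ] (∀ i → _≅_.to α (at (lookup b i)) ≈ tuple c i)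
  reach b c (x , moves) = automorphism x , λ i → Inverse.inverseʳ (_≅_.bijection G≅lineGraph)
    (subst₂ (Moves (permutation x)) (sym (label∘at _)) (lookup∘tabulate (label ∘ tuple c) i)
      (Pointwise.lookup moves i))

  extension : ∀ {n} (b : Vec Vertex n) (S S′ : VertexSet G) (g : induced G S ≅ K n)
    (f : induced G S ≅ induced G S′) → b ↝ labels (S , g) → b ↝ labels (S′ , ≅-trans (≅-sym f) g) →
    ExtendsToAutomorphism G S S′ f
  extension b S S′ g f m m′ =
    let α  , p  = reach b (S , g) m
        α′ , p′ = reach b (S′ , ≅-trans (≅-sym f) g) m′
    in extends (at ∘ lookup b) S S′ g f α α′ p p′

  ultrahomogeneous : ∀ {n} (b : Vec Vertex n) → (∀ t → AllPairs _⌢_ t → b ↝ t) → Ultrahomogeneous (K n) G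
  ultrahomogeneous b moved (S , g) (S′ , _) f = extension b S S′ g f
    -- `S′` gets the order `g` carried along `f`, which makes the automorphism agree with `f` vertex
    -- by vertex.
    (moved _ (labels-clique (S , g))) (moved _ (labels-clique (S′ , ≅-trans (≅-sym f) g)))

  triangle-moved : (k : CopyOutside G (K 3) (K 4)) → line (outer 0F) ↝ labels (proj₁ k)
  triangle-moved k = [ (λ in-star → contradiction in-star (not-in-star k)) , id ]′
    (3-cliques-moved _ (labels-clique (proj₁ k)))

  ultrahomogeneous-outside : UltrahomogeneousOutside (K 3) (K 4) G
  ultrahomogeneous-outside ((S , g) , o) ((S′ , _) , o′) f = extension (line (outer 0F)) S S′ g f
    -- `o′` concerns only the vertex set of `S′`, so it also holds for the reordered triangle.
    (triangle-moved ((S , g) , o)) (triangle-moved ((S′ , ≅-trans (≅-sym f) g) , o′))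

  star-of : ∀ {c} (h : Copy G (K 4)) → starCopy c ≈⁴ h →
    ∀ v → v ∈ᴳ proj₁ h ⇔ c ∈ᵉ label v
  star-of {c} h e v = ⇔-trans (⇔-sym (≡→T-⇔ (e v))) (∈starCopy⇔ c v)

  line-of : ∀ {ℓ} (k : CopyOutside G (K 3) (K 4)) → lineOutside ℓ ≈³ k →
    ∀ v → v ∈ᴳ proj₁ (proj₁ k) ⇔ label v ~ ℓ
  line-of {ℓ} k e v = ⇔-trans (⇔-sym (≡→T-⇔ (e v))) (∈lineCopy⇔ ℓ v)

  -- All three subgraphs are induced, so their edges are determined by their vertices.
  meetExactlyIn : (S S′ M : VertexSet G) → (∀ v → (v ∈ᴳ S × v ∈ᴳ S′) ⇔ v ∈ᴳ M) → MeetExactlyIn G S S′ M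
  meetExactlyIn S S′ M e = e , λ u v → mk⇔
    (λ ((u∈ , v∈ , a) , u∈′ , v∈′ , _) → ⇒ (e u) (u∈ , u∈′) , ⇒ (e v) (v∈ , v∈′) , a)
    (λ (u∈ , v∈ , a) → let u∈S , u∈S′ = ⇐ (e u) u∈ ; v∈S , v∈S′ = ⇐ (e v) v∈ in
      (u∈S , v∈S , a) , u∈S′ , v∈S′ , a)

  meeting : (m : Copy G (K 2)) → Σ[ h ∈ Copy G (K 4) ] Σ[ k ∈ CopyOutside G (K 3) (K 4) ]
    MeetExactlyIn G (proj₁ h) (proj₁ (proj₁ k)) (proj₁ m) ×
    ((h′ : Copy G (K 4)) (k′ : CopyOutside G (K 3) (K 4)) →
      MeetExactlyIn G (proj₁ h′) (proj₁ (proj₁ k′)) (proj₁ m) →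
      h ≈⁴ h′ × k ≈³ k′)
  meeting m with c , ℓ , e , c-unique , ℓ-unique ←
    star∩line _ _ (⇒ (adjacent⇔⌢ _ _) (tuple-adjacent m {0F} {1F} λ ())) =
    starCopy c , lineOutside ℓ
    , meetExactlyIn (proj₁ (starCopy c)) (proj₁ (lineCopy ℓ)) (proj₁ m) (λ v → ⇔-trans
        (mk⇔ (map (⇒ (∈starCopy⇔ c v)) (⇒ (∈lineCopy⇔ ℓ v))) (map (⇐ (∈starCopy⇔ c v)) (⇐ (∈lineCopy⇔ ℓ v))))
        (⇔-trans (e (label v)) (⇔-sym (∈⇔∈labels m v))))
    , unique
    where
    unique : ∀ h′ k′ → MeetExactlyIn G (proj₁ h′) (proj₁ (proj₁ k′)) (proj₁ m) →
      starCopy c ≈⁴ h′ × lineOutside ℓ ≈³ k′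
    unique h′ k′ (meet , _) with star-surjective h′ | line-surjective k′
    -- Both ends of `m` lie in the star of `c′` and on `ℓ′`, which leaves one choice for each.
    ... | c′ , p | ℓ′ , q = same (c-unique c′ (c′∈ 0F) (c′∈ 1F)) (ℓ-unique ℓ′ (∈ℓ′ 0F) (∈ℓ′ 1F))
      where
      both : ∀ i → tuple m i ∈ᴳ proj₁ h′ × tuple m i ∈ᴳ proj₁ (proj₁ k′)
      both i = ⇐ (meet _) (⇐ (∈⇔∈tuple m _) (i , G.refl))
      c′∈ : ∀ i → c′ ∈ᵉ label (tuple m i)
      c′∈ i = ⇒ (star-of h′ p _) (proj₁ (both i))
      ∈ℓ′ : ∀ i → label (tuple m i) ~ ℓ′
      ∈ℓ′ i = ⇒ (line-of k′ q _) (proj₂ (both i))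
      same : c ≡ c′ → ℓ ≡ ℓ′ → starCopy c ≈⁴ h′ × lineOutside ℓ ≈³ k′
      same refl refl = p , q

  coherent : Coherent (K 4) (K 3) (K 2) G
  coherent = record
    { M⊆H   = initialCopy 2 2
    ; K⊆H   = K⊆K-suc 3
    ; M⊆K   = K⊆K-suc 2
    ; M-UH  = ultrahomogeneous base₂ 2-cliques-moved
    ; H-UH  = ultrahomogeneous (star 0F) 4-cliques-moved
    ; K-UH  = ultrahomogeneous-outside
    ; meets = meeting
    }

  composed : ComposedOf 5 (K 4) 10 (K 3) G
  composed = record
    { #H         = stars
    ; #K         = Composition.inverse lines vertex-count
    -- Either element of the pair would do as the centre of a star; the first is taken.
    ; vertices-H = λ v → starCopy (proj₁ (proj₁ (edge (label v)))) , ⇐ (∈starCopy⇔ _ v) (inj₁ refl)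
    ; vertices-K = λ v → let ℓ , v~ℓ = line-through (label v) in lineOutside ℓ , ⇐ (∈lineCopy⇔ ℓ v) v~ℓ
    ; edges-H    = λ u v a → let c , _ , c∈ = common a in
        starCopy c , ⇐ (∈starCopy⇔ c u) (proj₁ (c∈ 0F)) , ⇐ (∈starCopy⇔ c v) (proj₁ (c∈ 1F)) , a
    ; edges-K    = λ u v a → let _ , ℓ , ∈ℓ = common a in
        lineOutside ℓ , ⇐ (∈lineCopy⇔ ℓ u) (proj₂ (∈ℓ 0F)) , ⇐ (∈lineCopy⇔ ℓ v) (proj₂ (∈ℓ 1F)) , a
    }
    where
    line-through : ∀ p → ∃[ ℓ ] p ~ ℓ
    line-through p = lookup (line p) 0F , symmetric _ (line-lookup-~ p 0F)

    common : ∀ {u v} → Adj u v →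
      ∃[ c ] ∃[ ℓ ] (∀ i → let r = lookup (label u ∷ label v ∷ []) i in c ∈ᵉ r × r ~ ℓ)
    common a with c , ℓ , e , _ ← star∩line _ _ (⇒ (adjacent⇔⌢ _ _) a) =
      c , ℓ , λ i → ⇐ (e _) (∈-lookup i _)

  𝒞 : Incidence
  𝒞 = copyConfiguration (K 3) (K 4) G

  𝒞≅Δ : 𝒞 ≅ᶜ Δ
  𝒞≅Δ = record
    { on-points = _≅_.bijection φ
    ; on-lines  = lines
    -- `lines` sends `k` to the `ℓ` found by `line-surjective`, which also proves that `k` is the
    -- triangle of `ℓ`.
    ; incidence = λ v k → line-of k (proj₂ (line-surjective k)) v
    }

  menger≅ : menger 𝒞 ≅ J
  menger≅ = ≅-trans (menger-cong 𝒞≅Δ) menger-Δ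

-- All properties for a graph isomorphic to `J`, and their application to `Y₁` and `Y₂`.

DesarguesProperties : Graph → Set
DesarguesProperties G = let 𝒞 = copyConfiguration (K 3) (K 4) G in
    Coherent (K 4) (K 3) (K 2) G ×
    ComposedOf 5 (K 4) 10 (K 3) G ×
    IsConfiguration 10 3 𝒞 ×
    SelfDual 𝒞 ×
    (𝒞 ≅ᶜ desarguesConfiguration) ×
    (levi 𝒞 ≅ 𝒟) ×
    (∀ u v → Graph.Adj (menger 𝒞) u v ⇔ Graph.Adj G u v) ×
    (menger 𝒞 ≅ Y₁) × (menger 𝒞 ≅ Y₂) ×
    (G ≅ lineGraph (K 5))

desarguesProperties : (G : Graph) → G ≅ J → DesarguesProperties G
desarguesProperties G φ =
    coherent
  , composed
  , IsConfiguration-resp 𝒞≅Δ Δ-configuration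
  , SelfDual-resp 𝒞≅Δ Δ-self-dual
  , ≅ᶜ-trans 𝒞≅Δ Δ≅desargues
  , ≅-trans (levi-cong 𝒞≅Δ) levi-Δ
  -- The vertex map of `menger≅` is that of `φ`, so the two graphs agree on the same vertices and
  -- not only up to isomorphism.
  , (λ u v → ⇔-trans (_≅_.adjacency menger≅ u v) (⇔-sym (adjacent⇔⌢ u v)))
  , ≅-trans menger≅ (≅-sym (component≅J 0F))
  , ≅-trans menger≅ (≅-sym (component≅J 1F))
  , G≅lineGraph
  where open Labelled G φ

theorem3 : (IsComponent Y part₁ × IsComponent Y part₂ ×
    (∀ v → (_∈ᵛ_ Y v part₁ × ¬ _∈ᵛ_ Y v part₂) ⊎ (_∈ᵛ_ Y v part₂ × ¬ _∈ᵛ_ Y v part₁))) ×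
    All (λ G →
    let 𝒞 = copyConfiguration (K 3) (K 4) G in
    Coherent (K 4) (K 3) (K 2) G ×
    ComposedOf 5 (K 4) 10 (K 3) G ×
    IsConfiguration 10 3 𝒞 ×
    SelfDual 𝒞 ×
    (𝒞 ≅ᶜ desarguesConfiguration) ×
    (levi 𝒞 ≅ 𝒟) ×
    (∀ u v → Graph.Adj (menger 𝒞) u v ⇔ Graph.Adj G u v) ×
    (menger 𝒞 ≅ Y₁) × (menger 𝒞 ≅ Y₂) ×
    (G ≅ lineGraph (K 5)))
    (Y₁ ∷ Y₂ ∷ []) ×
    (complement (lineGraph (K 5)) ≅ petersen)
theorem3 =
    (component 0F , component 1F , parts-partition)
  , desarguesProperties Y₁ (component≅J 0F) ∷ desarguesProperties Y₂ (component≅J 1F) ∷ []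
  , complement-lineGraph
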